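{- Let $q$ be a prime power. For all integers $m\geq4$ there exists a non-degenerate minimal $[m+3,3]_{q^m/q}$ code.
   Context: An $[\ell,k]_{q^m/q}$ code (vector rank-metric code) is a $k$-dimensional $\mathbb{F}_{q^m}$-linear subspace $\mathcal{C}\le\mathbb{F}_{q^m}^\ell$, $k\ge1$. For $c\in\mathbb{F}_{q^m}^\ell$ and an ordered basis $\Gamma=(\beta_1,\ldots,\beta_m)$ of $\mathbb{F}_{q^m}$ over $\mathbb{F}_q$, let $\Gamma(c)\in\mathbb{F}_q^{\ell\times m}$ be defined by $c_i=\sum_{j=1}^m\Gamma(c)_{ij}\beta_j$ for all $i$. The rank-support $\sigma^{\mathrm{rk}}(c)\le\mathbb{F}_q^\ell$ of $c$ is the column space of $\Gamma(c)$; it does not depend on $\Gamma$. A codeword $c\in\mathcal{C}$ is minimal if, for every $c'\in\mathcal{C}$, $\sigma^{\mathrm{rk}}(c')\leq\sigma^{\mathrm{rk}}(c)$ implies $c'=\alpha c$ for some $\alpha\in\mathbb{F}_{q^m}$. The code $\mathcal{C}$ is minimal if all its codewords are minimal. The code $\mathcal{C}$ is non-degenerate if the columns of any generator matrix of $\mathcal{C}$ (a $k\times\ell$ matrix over $\mathbb{F}_{q^m}$ whose rows form an $\mathbb{F}_{q^m}$-basis of $\mathcal{C}$) are $\mathbb{F}_q$-linearly independent. -}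

module Defs where

open import Level using (Level; _⊔_; suc)
open import Algebra.Apartness.Bundles using (HeytingCommutativeRing; HeytingField)
open import Algebra.Bundles using (CommutativeRing; Ring)
open import Algebra.Definitions.RawMonoid using (sum)
open import Algebra.Module.Bundles using (LeftModule)
open import Algebra.Module.Construct.TensorUnit using () renaming (leftModule to regular)
open import Algebra.Morphism.Structures using (module RingMorphisms)
open import Data.Fin.Base using (Fin)
open import Data.Nat.Base using (ℕ; _≤_; _^_)
open import Data.Nat.Primality using (Prime)
open import Data.Product.Base using (∃; ∃₂; _×_; _,_; proj₁; proj₂)
open import Data.Vec.Functional using (Vector)
open import Function.Bundles using (Inverse)
open import Relation.Binary.Definitions using (_Respects_)
open import Relation.Binary.PropositionalEquality using (_≡_)
  renaming (setoid to ≡-setoid)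
open import Relation.Unary using (Pred; _⊆_; _∈_; U)

IsPrimePower : ℕ → Set
IsPrimePower q = ∃₂ λ p e → Prime p × 1 ≤ e × q ≡ p ^ e

-- A finite Heyting field has decidable equality, and its
-- apartness is then x ≉ y: finite Heyting fields are the finite fields.

fieldCommutativeRing : ∀ {c ℓ a} → HeytingField c ℓ a → CommutativeRing c ℓ
fieldCommutativeRing F =
  HeytingCommutativeRing.commutativeRing (HeytingField.heytingCommutativeRing F)

fieldRing : ∀ {c ℓ a} → HeytingField c ℓ a → Ring c ℓ
fieldRing F = CommutativeRing.ring (fieldCommutativeRing F)

HasOrder : ∀ {c ℓ a} → HeytingField c ℓ a → ℕ → Set (c ⊔ ℓ)
HasOrder F n = Inverse (Ring.setoid (fieldRing F)) (≡-setoid (Fin n))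

record Extension {c ℓ a c′ ℓ′ a′ : Level}
                 (F : HeytingField c ℓ a) (K : HeytingField c′ ℓ′ a′)
                 : Set (c ⊔ ℓ ⊔ c′ ⊔ ℓ′) where
  open RingMorphisms (Ring.rawRing (fieldRing F)) (Ring.rawRing (fieldRing K))
    using (IsRingMonomorphism)
  field
    embed              : HeytingField.Carrier F → HeytingField.Carrier K
    isRingMonomorphism : IsRingMonomorphism embed
  open IsRingMonomorphism isRingMonomorphism public

-- A vector space is a left module over (the ring of) a
-- field, and a subspace is a predicate.

module LinearAlgebra {r ℓr m ℓm : Level} {R : Ring r ℓr}
                     (M : LeftModule R m ℓm) where
  open Ring R using (Carrier; _≈_; 0#)
  open LeftModule M using (Carrierᴹ; _≈ᴹ_; _+ᴹ_; _*ₗ_; 0ᴹ; +ᴹ-rawMonoid)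

  combination : ∀ {n} → Vector Carrier n → Vector Carrierᴹ n → Carrierᴹ
  combination a v = sum +ᴹ-rawMonoid (λ i → a i *ₗ v i)

  LinearlyIndependent : ∀ {n} → Vector Carrierᴹ n → Set (r ⊔ ℓr ⊔ ℓm)
  LinearlyIndependent v = ∀ a → combination a v ≈ᴹ 0ᴹ → ∀ i → a i ≈ 0#

  Span : ∀ {n} → Vector Carrierᴹ n → Pred Carrierᴹ (r ⊔ ℓm)
  Span v x = ∃ λ a → x ≈ᴹ combination a v

  record IsSubspace {p : Level} (P : Pred Carrierᴹ p)
                    : Set (r ⊔ m ⊔ ℓm ⊔ p) where
    field
      resp      : P Respects _≈ᴹ_
      0-closed  : 0ᴹ ∈ P
      +-closed  : ∀ {x y} → x ∈ P → y ∈ P → x +ᴹ y ∈ P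
      *ₗ-closed : ∀ a {x} → x ∈ P → a *ₗ x ∈ P

  record IsBasisOf {p : Level} (P : Pred Carrierᴹ p)
                   {n : ℕ} (v : Vector Carrierᴹ n)
                   : Set (r ⊔ ℓr ⊔ m ⊔ ℓm ⊔ p) where
    field
      member      : ∀ i → v i ∈ P
      independent : LinearlyIndependent v
      spanning    : P ⊆ Span v

power : ∀ {r ℓr m ℓm} {R : Ring r ℓr} → LeftModule R m ℓm → ℕ → LeftModule R m ℓm
power M n = record
  { Carrierᴹ = Vector M.Carrierᴹ n
  ; _≈ᴹ_     = λ x y → ∀ i → x i M.≈ᴹ y i
  ; _+ᴹ_     = λ x y i → x i M.+ᴹ y i
  ; _*ₗ_     = λ a x i → a M.*ₗ x i
  ; 0ᴹ       = λ _ → M.0ᴹ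
  ; -ᴹ_      = λ x i → M.-ᴹ x i
  ; isLeftModule = record
    { isLeftSemimodule = record
      { +ᴹ-isCommutativeMonoid = record
        { isMonoid = record
          { isSemigroup = record
            { isMagma = record
              { isEquivalence = record
                { refl  = λ _ → M.≈ᴹ-refl
                ; sym   = λ p i → M.≈ᴹ-sym (p i)
                ; trans = λ p q i → M.≈ᴹ-trans (p i) (q i)
                }
              ; ∙-cong = λ p q i → M.+ᴹ-cong (p i) (q i)
              }
            ; assoc = λ x y z i → M.+ᴹ-assoc (x i) (y i) (z i)
            }
          ; identity = (λ x i → M.+ᴹ-identityˡ (x i)) , (λ x i → M.+ᴹ-identityʳ (x i))
          }
        ; comm = λ x y i → M.+ᴹ-comm (x i) (y i)
        }
      ; isPreleftSemimodule = record
        { *ₗ-cong      = λ p q i → M.*ₗ-cong p (q i)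
        ; *ₗ-zeroˡ     = λ x i → M.*ₗ-zeroˡ (x i)
        ; *ₗ-distribʳ  = λ x a b i → M.*ₗ-distribʳ (x i) a b
        ; *ₗ-identityˡ = λ x i → M.*ₗ-identityˡ (x i)
        ; *ₗ-assoc     = λ a b x i → M.*ₗ-assoc a b (x i)
        ; *ₗ-zeroʳ     = λ a _ → M.*ₗ-zeroʳ a
        ; *ₗ-distribˡ  = λ a x y i → M.*ₗ-distribˡ a (x i) (y i)
        }
      }
    ; -ᴹ‿cong    = λ p i → M.-ᴹ‿cong (p i)
    ; -ᴹ‿inverse = (λ x i → M.-ᴹ‿inverseˡ (x i)) , (λ x i → M.-ᴹ‿inverseʳ (x i))
    }
  }
  where module M = LeftModule M

coordinateSpace : ∀ {c ℓ a} (F : HeytingField c ℓ a) → ℕ → LeftModule (fieldRing F) c ℓ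
coordinateSpace F = power regular

module _ {c ℓ a c′ ℓ′ a′ : Level}
         {F : HeytingField c ℓ a} {K : HeytingField c′ ℓ′ a′}
         (E : Extension F K) where

  restrictScalars : ∀ {m ℓm} → LeftModule (fieldRing K) m ℓm →
                    LeftModule (fieldRing F) m ℓm
  restrictScalars M = record
    { _≈ᴹ_ = M._≈ᴹ_
    ; _+ᴹ_ = M._+ᴹ_
    ; _*ₗ_ = λ x → E.embed x M.*ₗ_
    ; 0ᴹ   = M.0ᴹ
    ; -ᴹ_  = M.-ᴹ_
    ; isLeftModule = record
      { isLeftSemimodule = record
        { +ᴹ-isCommutativeMonoid = M.+ᴹ-isCommutativeMonoid
        ; isPreleftSemimodule = record
          { *ₗ-cong      = λ p → M.*ₗ-cong (E.⟦⟧-cong p)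
          ; *ₗ-zeroˡ     = λ x → M.≈ᴹ-trans (scalar E.0#-homo) (M.*ₗ-zeroˡ x)
          ; *ₗ-distribʳ  = λ x b d →
              M.≈ᴹ-trans (scalar (E.+-homo b d)) (M.*ₗ-distribʳ x (E.embed b) (E.embed d))
          ; *ₗ-identityˡ = λ x → M.≈ᴹ-trans (scalar E.1#-homo) (M.*ₗ-identityˡ x)
          ; *ₗ-assoc     = λ b d x →
              M.≈ᴹ-trans (scalar (E.*-homo b d)) (M.*ₗ-assoc (E.embed b) (E.embed d) x)
          ; *ₗ-zeroʳ     = λ b → M.*ₗ-zeroʳ (E.embed b)
          ; *ₗ-distribˡ  = λ b → M.*ₗ-distribˡ (E.embed b)
          }
        }
      ; -ᴹ‿cong    = M.-ᴹ‿cong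
      ; -ᴹ‿inverse = M.-ᴹ‿inverse
      }
    }
    where
    module M = LeftModule M
    module E = Extension E
    scalar : ∀ {b d x} → HeytingField._≈_ K b d → (b M.*ₗ x) M.≈ᴹ (d M.*ₗ x)
    scalar p = M.*ₗ-cong p M.≈ᴹ-refl

record Code {c ℓ a : Level} (K : HeytingField c ℓ a) (p : Level) (l k : ℕ)
            : Set (c ⊔ ℓ ⊔ suc p) where
  open LeftModule (coordinateSpace K l) using (Carrierᴹ)
  open LinearAlgebra (coordinateSpace K l) using (IsSubspace; IsBasisOf)

  field
    1≤k        : 1 ≤ k
    Codeword   : Pred Carrierᴹ p
    isSubspace : IsSubspace Codeword

  -- A matrix is given by its rows: entry (i , j) is G i j.
  IsGeneratorMatrix : Vector Carrierᴹ k → Set (c ⊔ ℓ ⊔ p)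
  IsGeneratorMatrix = IsBasisOf Codeword

  field
    dimension : ∃ IsGeneratorMatrix

module _ {c ℓ a c′ ℓ′ a′ : Level}
         {F : HeytingField c ℓ a} {K : HeytingField c′ ℓ′ a′}
         (E : Extension F K) where
  private
    module F = HeytingField F
    module K = HeytingField K

  OrderedBasis : ℕ → Set (c ⊔ ℓ ⊔ c′ ⊔ ℓ′)
  OrderedBasis m = ∃ λ (β : Vector K.Carrier m) → IsBasisOf U β
    where open LinearAlgebra (restrictScalars E regular) using (IsBasisOf)

  -- The matrix Γ(v).  Its entries are determined up to F._≈_, since Γ is
  -- independent.
  expansion : ∀ {m l} → OrderedBasis m → Vector K.Carrier l →
              Fin l → Fin m → F.Carrier
  expansion (_ , isBasis) v i = proj₁ (spanning {x = v i} _)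
    where open LinearAlgebra.IsBasisOf isBasis using (spanning)

  rankSupport : ∀ {m l} → OrderedBasis m → Vector K.Carrier l →
                Pred (Vector F.Carrier l) (c ⊔ ℓ)
  rankSupport {l = l} Γ v = Span (λ j i → expansion Γ v i j)
    where open LinearAlgebra (coordinateSpace F l) using (Span)

  module _ {p : Level} {l k : ℕ} (C : Code K p l k) where
    open Code C
    open LeftModule (coordinateSpace K l) using (_≈ᴹ_; _*ₗ_)

    IsMinimalCodeword : ∀ {m} → OrderedBasis m → Vector K.Carrier l → Set _
    IsMinimalCodeword Γ v =
      ∀ v′ → v′ ∈ Codeword → rankSupport Γ v′ ⊆ rankSupport Γ v →
      ∃ λ α → v′ ≈ᴹ (α *ₗ v)

    IsMinimal : ∀ {m} → OrderedBasis m → Set _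
    IsMinimal Γ = ∀ v → v ∈ Codeword → IsMinimalCodeword Γ v

    -- The columns of G lie in Kᵏ, but their independence is over F.
    IsNonDegenerate : Set _
    IsNonDegenerate =
      ∀ G → IsGeneratorMatrix G → LinearlyIndependent (λ j i → G i j)
      where open LinearAlgebra (restrictScalars E (coordinateSpace K k))
              using (LinearlyIndependent)

{-# OPTIONS --safe #-}

-- The code is generated by a matrix whose columns span the F-space
--   U = { (z , z^q + a , b) ∣ z ∈ K, a ∈ F, b ∈ B } ⊆ K³,   dim B = 2, dim U = m + 3.
-- An F-linear form on the columns annihilates the codeword of x ∈ K³ exactly when the
-- corresponding point of U lies on the hyperplane x^⊥, so minimality says that y is a
-- multiple of x whenever U ∩ x^⊥ ⊆ y^⊥.  This holds once U ∩ x^⊥ spans x^⊥ over K.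
-- If (0 , 0 , 1) ∈ x^⊥, it is enough to find a nonzero point of U ∩ x^⊥ with b = 0, which
-- exists by the pigeonhole principle.  Otherwise the points with a = 0 are determined by z, and
-- the pigeonhole principle yields two F-independent ones; (z , z^q) and (z′ , z′^q) are
-- proportional only if z′/z is fixed by the Frobenius map, that is, z′ ∈ F z.

module Submission where

open import Level using (Level; _⊔_)
open import Algebra.Apartness.Bundles using (HeytingField)
open import Algebra.Apartness.Properties.HeytingCommutativeRing using (1#0; x-0≈x)
open import Algebra.Bundles using (CommutativeMonoid; CommutativeRing; CommutativeSemiring; Ring)
open import Algebra.Module.Bundles using (LeftModule)
open import Algebra.Module.Construct.TensorUnit using () renaming (leftModule to regular)
import Algebra.Properties.CommutativeMonoid.Sum
import Algebra.Properties.CommutativeSemigroup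
import Algebra.Properties.CommutativeSemiring.Binomial
import Algebra.Properties.CommutativeSemiring.Exp
import Algebra.Properties.Group
import Algebra.Properties.Ring
import Algebra.Properties.Semiring.Mult
import Algebra.Solver.Ring.NaturalCoefficients.Default
open import Data.Fin.Base using
  ( Fin; zero; suc; toℕ; fromℕ; fromℕ<; inject₁; punchIn; combine
  ; finToFun; funToFin; _↑ˡ_; _↑ʳ_; splitAt; join )
open import Data.Fin.Patterns using (0F; 1F; 2F)
open import Data.Fin.Permutation using (Permutation′; permutation; _⟨$⟩ʳ_)
open import Data.Fin.Properties using
  ( any?; all?; ¬∀⟶∃¬; punchInᵢ≢i; toℕ-fromℕ; toℕ-inject₁; toℕ<n; suc-injective
  ; combine-injective; finToFun-funToFin; funToFin-finToFin; pigeonhole; injective⇒≤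
  ; <⇒≢; join-splitAt )
  renaming (_≟_ to _≟ᶠ_)
open import Data.Nat.Base as ℕ using (ℕ; zero; suc; _≤_; _<_; _!; z≤n; s≤s)
  renaming (_+_ to _+ℕ_; _*_ to _*ℕ_; _^_ to _^ℕ_; _∸_ to _∸ℕ_)
open import Data.Nat.Combinatorics using (nCn≡1; nCk≡n!/k![n-k]!; k![n∸k]!∣n!)
  renaming (_C_ to _choose_)
open import Data.Nat.DivMod using (m/n*n≡m)
open import Data.Nat.Divisibility using (_∣_; divides; m∣m*n; ∣⇒≤)
open import Data.Nat.Primality using (Prime; euclidsLemma; prime⇒nonTrivial)
import Data.Nat.Properties as ℕ
open import Data.Product.Base using (Σ; ∃; _×_; _,_; proj₁; proj₂)
open import Data.Sum.Base using (inj₁; inj₂; [_,_]′)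
open import Data.Sum.Properties using ([,]-map)
open import Data.Vec.Functional using (Vector; replicate; _++_; _∷_; [])
open import Data.Vec.Functional.Properties using (lookup-++ˡ; lookup-++ʳ)
open import Function.Base using (_∘_)
open import Function.Bundles using (Inverse)
open import Relation.Binary.Definitions using (Decidable; _Respects_)
open import Relation.Binary.PropositionalEquality as ≡ using (_≡_; _≢_)
import Relation.Binary.Reasoning.Setoid
open import Relation.Nullary using (Dec; yes; no; ¬_; contradiction)
import Relation.Nullary.Decidable as Dec
open import Relation.Unary using (Pred; _∈_; _⊆_)
open import Defs

-- The Frobenius endomorphism

-- The shape of `U` comes from a dimension count. Its points have `m + 3` coefficients over `F` and
-- `x^⊥` imposes `m` conditions, so two further coefficients can always be made to vanish on a
-- nonzero point. If (0 , 0 , 1) lies in `x^⊥`, both conditions are spent on b = 0. What is left is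
-- an `F`-space of dimension `m + 1` in K², which meets every K-line through 0; { (z , z^q) } alone
-- misses the line of (1 , 0), for example, and this is why a is there. If (0 , 0 , 1) is not in
-- `x^⊥`, a has to be switched off, since no `F`-subspace of K² of dimension `m + 1` is scattered.
-- This costs one condition, and the two dimensions of B leave a solution space of dimension at
-- least two. The other condition then certifies independence: the second point is made to vanish at
-- a coefficient where the first does not. Counting takes the place of dimension theory: kernels are
-- found by comparing numbers of coefficient vectors, and the fixed field of the Frobenius map by
-- counting roots of X^q - X.

module _ {p : ℕ} (prime : Prime p) where

  ∤-! : ∀ {k} → k < p → ¬ (p ∣ k !)
  ∤-! {zero} _ p∣1 =
    ℕ.≤⇒≯ (∣⇒≤ p∣1) (ℕ.nonTrivial⇒n>1 p {{prime⇒nonTrivial prime}})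
  ∤-! {suc k} k<p p∣ =
    [ (λ p∣k → ℕ.≤⇒≯ (∣⇒≤ p∣k) k<p) , ∤-! (ℕ.<-trans (ℕ.n<1+n k) k<p) ]′
      (euclidsLemma (suc k) (k !) prime p∣)

  -- The product of the binomial with `k !` and `(p ∸ k) !` is `p !`, which `p` divides, while
  -- neither factorial has the factor `p`.
  ∣-binomial : ∀ {k} → 0 < k → k < p → p ∣ p choose k
  ∣-binomial {k} 0<k k<p with euclidsLemma (p choose k) (k ! *ℕ (p ∸ℕ k) !) prime p∣prod
    where
    instance _ = k ℕ.!* (p ∸ℕ k) !≢0
    prod≡p! : (p choose k) *ℕ (k ! *ℕ (p ∸ℕ k) !) ≡ p !
    prod≡p! = ≡.trans (≡.cong (_*ℕ (k ! *ℕ (p ∸ℕ k) !)) (nCk≡n!/k![n-k]! (ℕ.<⇒≤ k<p)))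
                      (m/n*n≡m (k![n∸k]!∣n! (ℕ.<⇒≤ k<p)))
    ∣-! : ∀ {k n} → k < n → n ∣ n !
    ∣-! {n = suc n} _ = m∣m*n (n !)
    p∣prod : p ∣ (p choose k) *ℕ (k ! *ℕ (p ∸ℕ k) !)
    p∣prod = ≡.subst (p ∣_) (≡.sym prod≡p!) (∣-! k<p)
  ... | inj₁ p∣C = p∣C
  ... | inj₂ p∣d = contradiction (euclidsLemma (k !) ((p ∸ℕ k) !) prime p∣d)
    [ ∤-! k<p , ∤-! (ℕ.∸-monoʳ-< 0<k (ℕ.<⇒≤ k<p)) ]′

module Frobenius {c ℓ} (R : CommutativeSemiring c ℓ) where
  open CommutativeSemiring R hiding (zero)
  open Algebra.Properties.CommutativeSemiring.Exp R
  open Algebra.Properties.Semiring.Mult semiring using (×-congʳ; ×-congˡ; ×-homo-1; ×-assoc-*; ×-assocˡ)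
    renaming (_×_ to _·_)
  open Algebra.Properties.CommutativeSemiring.Binomial R
  open Algebra.Properties.CommutativeMonoid.Sum +-commutativeMonoid
  open Relation.Binary.Reasoning.Setoid setoid

  module _ {p} (prime : Prime p) (p·1≈0 : p · 1# ≈ 0#) where

    ∣⇒·≈0 : ∀ {n} → p ∣ n → ∀ x → n · x ≈ 0#
    ∣⇒·≈0 (divides k ≡.refl) x = begin
      (k *ℕ p) · x       ≈⟨ ×-congˡ (ℕ.*-comm k p) ⟩
      (p *ℕ k) · x       ≈⟨ ×-assocˡ x p k ⟨
      p · (k · x)        ≈⟨ ×-congʳ p (*-identityˡ _) ⟨
      p · (1# * (k · x)) ≈⟨ ×-assoc-* p 1# _ ⟨
      (p · 1#) * (k · x) ≈⟨ *-congʳ p·1≈0 ⟩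
      0# * (k · x)       ≈⟨ zeroˡ _ ⟩
      0#                 ∎

    ^p-distrib-+ : ∀ x y → (x + y) ^ p ≈ x ^ p + y ^ p
    ^p-distrib-+ x y = expand p ≡.refl
      where
      -- Matching on `n` exposes `p` as a successor, which splitting off the first and the last
      -- binomial term requires.
      expand : ∀ n → n ≡ p → (x + y) ^ n ≈ x ^ n + y ^ n
      expand zero    ≡.refl = contradiction (ℕ.nonTrivial⇒n>1 p {{prime⇒nonTrivial prime}}) λ ()
      expand (suc n) ≡.refl = begin
        (x + y) ^ p
          ≈⟨ theorem p x y ⟩
        first + sum (λ k → binomialTerm x y p (suc k))
          ≈⟨ +-congˡ (sum-init-last (λ k → binomialTerm x y p (suc k))) ⟩
        first + (sum (λ k → binomialTerm x y p (suc (inject₁ k))) + last)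
          ≈⟨ +-congˡ (+-congʳ (sum-cong-≋ middle≈0)) ⟩
        first + (sum {n} (replicate n 0#) + last)
          ≈⟨ +-cong first≈ (+-cong (sum-replicate-zero n) last≈) ⟩
        y ^ p + (0# + x ^ p)
          ≈⟨ +-congˡ (+-identityˡ _) ⟩
        y ^ p + x ^ p
          ≈⟨ +-comm _ _ ⟩
        x ^ p + y ^ p
          ∎
        where
        first = binomialTerm x y p zero
        last = binomialTerm x y p (suc (fromℕ n))
        first≈ : first ≈ y ^ p
        first≈ = trans (×-homo-1 _) (*-identityˡ _)
        last≈ : last ≈ x ^ p
        last≈ rewrite toℕ-fromℕ n | nCn≡1 (suc n) | ℕ.n∸n≡0 n =
          trans (×-homo-1 _) (*-identityʳ _)
        middle≈0 : ∀ (k : Fin n) → binomialTerm x y p (suc (inject₁ k)) ≈ 0#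
        middle≈0 k = ∣⇒·≈0 (∣-binomial prime (s≤s z≤n)
          (s≤s (≡.subst (_< n) (≡.sym (toℕ-inject₁ k)) (toℕ<n k)))) _

    ^[p^e]-distrib-+ : ∀ e x y → (x + y) ^ (p ^ℕ e) ≈ x ^ (p ^ℕ e) + y ^ (p ^ℕ e)
    ^[p^e]-distrib-+ zero x y = trans (*-identityʳ _) (sym (+-cong (*-identityʳ _) (*-identityʳ _)))
    ^[p^e]-distrib-+ (suc e) x y = begin
      (x + y) ^ (p *ℕ p ^ℕ e)                   ≈⟨ ^-assocʳ (x + y) p (p ^ℕ e) ⟨
      ((x + y) ^ p) ^ (p ^ℕ e)                  ≈⟨ ^-congˡ (p ^ℕ e) (^p-distrib-+ x y) ⟩
      (x ^ p + y ^ p) ^ (p ^ℕ e)                ≈⟨ ^[p^e]-distrib-+ e (x ^ p) (y ^ p) ⟩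
      (x ^ p) ^ (p ^ℕ e) + (y ^ p) ^ (p ^ℕ e)   ≈⟨ +-cong (^-assocʳ x p (p ^ℕ e)) (^-assocʳ y p (p ^ℕ e)) ⟩
      x ^ (p *ℕ p ^ℕ e) + y ^ (p *ℕ p ^ℕ e)     ∎

-- Finite fields

module FiniteField {c ℓ a} (F : HeytingField c ℓ a) {n : ℕ} (order : HasOrder F n) where
  open CommutativeRing (fieldCommutativeRing F) hiding (zero)
  open Algebra.Properties.CommutativeSemiring.Exp commutativeSemiring
  open Algebra.Properties.Semiring.Mult semiring using (×-congˡ; ×1-homo-*) renaming (_×_ to _·_)
  open Algebra.Properties.Ring ring using (+-cancelʳ; -1*x≈-x)
  open Relation.Binary.Reasoning.Setoid setoid
  open Inverse order public
    using (strictlyInverseˡ; strictlyInverseʳ; from-cong)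
    renaming (to to index; from to element; to-cong to index-cong)

  open Algebra.Solver.Ring.NaturalCoefficients.Default commutativeSemiring
    using (solve; _:+_; _:*_; _:=_)

  1≉0 : ¬ 1# ≈ 0#
  1≉0 1≈0 = HeytingField.#-irrefl F 1≈0 (1#0 (HeytingField.heytingCommutativeRing F))

  index-injective : ∀ {x y} → index x ≡ index y → x ≈ y
  index-injective {x} {y} eq =
    trans (sym (strictlyInverseʳ x)) (trans (from-cong eq) (strictlyInverseʳ y))

  1<order : 1 < n
  1<order = distinct (index 0#) (index 1#) (λ eq → 1≉0 (sym (index-injective eq)))
    where
    distinct : ∀ {k} (i j : Fin k) → i ≢ j → 1 < k
    distinct {suc zero}    zero zero i≢j = contradiction ≡.refl i≢j
    distinct {suc (suc k)} _    _    _   = s≤s (s≤s z≤n)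

  infix 4 _≟_
  _≟_ : Decidable _≈_
  x ≟ y = Dec.map′ index-injective index-cong (index x ≟ᶠ index y)

  exists? : ∀ {p} {P : Pred Carrier p} → P Respects _≈_ → (∀ x → Dec (P x)) → Dec (∃ P)
  exists? resp P? = Dec.map′ (λ (i , Pi) → element i , Pi)
    (λ (x , Px) → index x , resp (sym (strictlyInverseʳ x)) Px)
    (any? (λ i → P? (element i)))

  -- A Heyting field inverts what is apart from 0, whereas here only inequality is given. Searching
  -- the finite field bridges the gap: if no inverse exists, `x` is not apart from 0, and tightness
  -- makes it equal to 0.
  inverse : ∀ {x} → ¬ x ≈ 0# → ∃ λ y → x * y ≈ 1#
  inverse {x} x≉0 with exists? (λ p xy≈1 → trans (*-congˡ (sym p)) xy≈1) (λ y → x * y ≟ 1#)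
  ... | yes x⁻¹ = x⁻¹
  ... | no ¬x⁻¹ = contradiction (proj₁ (HeytingField.tight F x 0#) ¬x#0) x≉0
    where
    ¬x#0 : ¬ HeytingField._#_ F x 0#
    ¬x#0 x#0 with y , _ , eq ← HeytingField.#⇒invertible F x#0 =
      ¬x⁻¹ (y , trans (*-congʳ (sym (x-0≈x (HeytingField.heytingCommutativeRing F) x))) eq)

  *-cancelˡ-nonZero : ∀ {x y z} → ¬ x ≈ 0# → x * y ≈ x * z → y ≈ z
  *-cancelˡ-nonZero {x} {y} {z} x≉0 eq with x⁻¹ , xx⁻¹≈1 ← inverse x≉0 =
    trans (sym (undo y)) (trans (*-congˡ eq) (undo z))
    where
    undo : ∀ w → x⁻¹ * (x * w) ≈ w
    undo w = trans (sym (*-assoc _ _ _))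
      (trans (*-congʳ (trans (*-comm _ _) xx⁻¹≈1)) (*-identityˡ w))

  zeroProductʳ : ∀ {x y} → ¬ x ≈ 0# → x * y ≈ 0# → y ≈ 0#
  zeroProductʳ x≉0 eq = *-cancelˡ-nonZero x≉0 (trans eq (sym (zeroʳ _)))

  ^-zero⇒≈0 : ∀ {x} k → x ^ k ≈ 0# → x ≈ 0#
  ^-zero⇒≈0 zero    eq = contradiction eq 1≉0
  ^-zero⇒≈0 {x} (suc k) eq with x ≟ 0#
  ... | yes x≈0 = x≈0
  ... | no  x≉0 = ^-zero⇒≈0 k (zeroProductʳ x≉0 eq)

  -- Sums and products run over `Fin n`, so a bijection of the field must become one of the indices
  -- before they can be reordered along it.
  bijection : (f g : Carrier → Carrier) → (∀ {x y} → x ≈ y → f x ≈ f y) →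
              (∀ {x y} → x ≈ y → g x ≈ g y) →
              (∀ x → f (g x) ≈ x) → (∀ x → g (f x) ≈ x) → Permutation′ n
  bijection f g f-cong g-cong f∘g g∘f = permutation
    (index ∘ f ∘ element) (index ∘ g ∘ element)
    (λ i → ≡.trans (index-cong (trans (f-cong (strictlyInverseʳ _)) (f∘g _))) (strictlyInverseˡ i))
    (λ i → ≡.trans (index-cong (trans (g-cong (strictlyInverseʳ _)) (g∘f _))) (strictlyInverseˡ i))

  module _ where
    open Algebra.Properties.CommutativeMonoid.Sum +-commutativeMonoid

    -- Translation by 1 permutes the field, so adding n copies of 1 does not
    -- change the sum of all elements.
    order·1≈0 : n · 1# ≈ 0#
    order·1≈0 = +-cancelʳ (sum element) _ _ (begin
      n · 1# + sum element                     ≈⟨ +-congʳ (sum-replicate n) ⟨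
      sum {n} (λ _ → 1#) + sum element         ≈⟨ ∑-distrib-+ (λ _ → 1#) element ⟨
      sum (λ i → 1# + element i)               ≈⟨ sum-cong-≋ {n} (λ i → strictlyInverseʳ (1# + element i)) ⟨
      sum (λ i → element (translation ⟨$⟩ʳ i)) ≈⟨ sum-permute element translation ⟨
      sum element                              ≈⟨ +-identityˡ _ ⟨
      0# + sum element                         ∎)
      where
      cancel : ∀ {u v} w → u + v ≈ 0# → u + (v + w) ≈ w
      cancel w eq = trans (sym (+-assoc _ _ _)) (trans (+-congʳ eq) (+-identityˡ w))
      translation = bijection (1# +_) (- 1# +_) +-congˡ +-congˡ
        (λ x → cancel x (-‿inverseʳ 1#)) (λ x → cancel x (-‿inverseˡ 1#))

  -- The `e`-th power of `p · 1` is `p ^ e · 1 = n · 1 = 0`, and a field has no nonzero nilpotent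
  -- element.
  characteristic : ∀ {p e} → n ≡ p ^ℕ e → p · 1# ≈ 0#
  characteristic {p} {e} eq = ^-zero⇒≈0 e (trans (^-of-·1 e) (trans (×-congˡ (≡.sym eq)) order·1≈0))
    where
    ^-of-·1 : ∀ e → (p · 1#) ^ e ≈ (p ^ℕ e) · 1#
    ^-of-·1 zero    = sym (+-identityʳ 1#)
    ^-of-·1 (suc e) = trans (*-congˡ (^-of-·1 e)) (sym (×1-homo-* p (p ^ℕ e)))

  module _ where
    open Algebra.Properties.CommutativeMonoid.Sum *-commutativeMonoid
      renaming (sum to product; sum-remove to product-remove; sum-cong-≋ to product-cong;
                sum-replicate to product-replicate; ∑-distrib-+ to product-distrib-*;
                sum-permute to product-permute)

    private
      -- With 0 replaced by 1, the product over all indices becomes the product of the nonzero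
      -- elements, and no index has to be removed.
      nonZeroPart : Carrier → Carrier
      nonZeroPart x with x ≟ 0#
      ... | yes _ = 1#
      ... | no  _ = x

      nonZeroPart≉0 : ∀ x → ¬ nonZeroPart x ≈ 0#
      nonZeroPart≉0 x with x ≟ 0#
      ... | yes _   = 1≉0
      ... | no  x≉0 = x≉0

      nonZeroPart-cong : ∀ {x y} → x ≈ y → nonZeroPart x ≈ nonZeroPart y
      nonZeroPart-cong {x} {y} eq with x ≟ 0# | y ≟ 0#
      ... | yes _   | yes _   = refl
      ... | yes x≈0 | no y≉0  = contradiction (trans (sym eq) x≈0) y≉0
      ... | no x≉0  | yes y≈0 = contradiction (trans eq y≈0) x≉0
      ... | no _    | no _    = eq

      scaleUnless0 : Carrier → Carrier → Carrier
      scaleUnless0 d x with x ≟ 0#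
      ... | yes _ = 1#
      ... | no  _ = d

      nonZeroPart-* : ∀ {d} → ¬ d ≈ 0# → ∀ x →
                      nonZeroPart (d * x) ≈ scaleUnless0 d x * nonZeroPart x
      nonZeroPart-* {d} d≉0 x with d * x ≟ 0# | x ≟ 0#
      ... | yes _    | yes _   = sym (*-identityˡ 1#)
      ... | yes dx≈0 | no x≉0  = contradiction (zeroProductʳ d≉0 dx≈0) x≉0
      ... | no dx≉0  | yes x≈0 = contradiction (trans (*-congˡ x≈0) (zeroʳ d)) dx≉0
      ... | no _     | no _    = refl

      product≉0 : ∀ {k} (f : Vector Carrier k) → (∀ i → ¬ f i ≈ 0#) → ¬ product f ≈ 0#
      product≉0 {zero}  f f≉0 = 1≉0
      product≉0 {suc k} f f≉0 eq = product≉0 (f ∘ suc) (f≉0 ∘ suc) (zeroProductʳ (f≉0 zero) eq)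

      -- The single zero entry contributes 1 and every other entry `d`; the extra `d` in front makes
      -- up for it, so that the exponent is `k` and not its predecessor.
      product-scale : ∀ d {k} (v : Vector Carrier k) i → v i ≈ 0# →
                      (∀ j → j ≢ i → ¬ v j ≈ 0#) → d * product (scaleUnless0 d ∘ v) ≈ d ^ k
      product-scale d {suc k} v i vi≈0 v≉0 = *-congˡ (begin
        product (scaleUnless0 d ∘ v)    ≈⟨ product-remove {i = i} (scaleUnless0 d ∘ v) ⟩
        scaleUnless0 d (v i) * product (λ j → scaleUnless0 d (v (punchIn i j)))
                                        ≈⟨ *-cong head≈1 (product-cong tail≈d) ⟩
        1# * product {k} (replicate k d) ≈⟨ *-identityˡ _ ⟩
        product {k} (replicate k d)     ≈⟨ product-replicate k ⟩
        d ^ k                           ∎)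
        where
        head≈1 : scaleUnless0 d (v i) ≈ 1#
        head≈1 with v i ≟ 0#
        ... | yes _   = refl
        ... | no vi≉0 = contradiction vi≈0 vi≉0
        tail≈d : ∀ j → scaleUnless0 d (v (punchIn i j)) ≈ d
        tail≈d j with v (punchIn i j) ≟ 0#
        ... | yes vj≈0 = contradiction vj≈0 (v≉0 (punchIn i j) (punchInᵢ≢i i j))
        ... | no _     = refl

      -- Multiplication by d permutes the field, so multiplying the n ∸ 1 nonzero
      -- elements by d does not change their product.
      product-scale≈1 : ∀ {d} → ¬ d ≈ 0# → product (scaleUnless0 d ∘ element) ≈ 1#
      product-scale≈1 {d} d≉0 with d⁻¹ , dd⁻¹≈1 ← inverse d≉0 =
        *-cancelˡ-nonZero (product≉0 (nonZeroPart ∘ element) (nonZeroPart≉0 ∘ element)) (begin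
          P * product (scaleUnless0 d ∘ element)
            ≈⟨ *-comm _ _ ⟩
          product (scaleUnless0 d ∘ element) * P
            ≈⟨ product-distrib-* (scaleUnless0 d ∘ element) (nonZeroPart ∘ element) ⟨
          product (λ i → scaleUnless0 d (element i) * nonZeroPart (element i))
            ≈⟨ product-cong {n} (λ i → nonZeroPart-* d≉0 (element i)) ⟨
          product (λ i → nonZeroPart (d * element i))
            ≈⟨ product-cong {n} (λ i → nonZeroPart-cong (strictlyInverseʳ (d * element i))) ⟨
          product (λ i → nonZeroPart (element (dilation ⟨$⟩ʳ i)))
            ≈⟨ product-permute (nonZeroPart ∘ element) dilation ⟨
          P
            ≈⟨ *-identityʳ P ⟨
          P * 1# ∎)
        where
        P = product (nonZeroPart ∘ element)
        cancel : ∀ {u v} w → u * v ≈ 1# → u * (v * w) ≈ w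
        cancel w eq = trans (sym (*-assoc _ _ _)) (trans (*-congʳ eq) (*-identityˡ w))
        dilation = bijection (d *_) (d⁻¹ *_) *-congˡ *-congˡ
          (λ x → cancel x dd⁻¹≈1) (λ x → cancel x (trans (*-comm _ _) dd⁻¹≈1))

    ^-order : ∀ d → d ^ n ≈ d
    ^-order d with d ≟ 0#
    ... | no d≉0 = begin
      d ^ n                                     ≈⟨ product-scale d element (index 0#) (strictlyInverseʳ 0#) nonzero ⟨
      d * product (scaleUnless0 d ∘ element)    ≈⟨ *-congˡ (product-scale≈1 d≉0) ⟩
      d * 1#                                    ≈⟨ *-identityʳ d ⟩
      d                                         ∎
      where
      nonzero : ∀ j → j ≢ index 0# → ¬ element j ≈ 0#
      nonzero j j≢ eq = j≢ (≡.trans (≡.sym (strictlyInverseˡ j)) (index-cong eq))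
    -- An index in `Fin n` shows that the exponent is positive; the zeroth power of 0 would be 1.
    ... | yes d≈0 = zeroPower (index 0#)
      where
      zeroPower : ∀ {k} → Fin k → d ^ k ≈ d
      zeroPower {suc k} _ = trans (*-congʳ d≈0) (trans (zeroˡ _) (sym d≈0))

  -- Monic polynomials as functions, given by their Horner form.
  data Monic : ℕ → (Carrier → Carrier) → Set (c ⊔ ℓ) where
    one    : ∀ {f} → (∀ x → f x ≈ 1#) → Monic 0 f
    horner : ∀ {k f g} b → (∀ x → f x ≈ b + x * g x) → Monic k g → Monic (suc k) f

  monic-power : ∀ k → Monic k (_^ k)
  monic-power zero    = one (λ _ → refl)
  monic-power (suc k) = horner 0# (λ _ → sym (+-identityˡ _)) (monic-power k)

  -- This is f(x) - f(r) = (x - r) g(x) with the negative terms moved across, so that semiring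
  -- identities suffice. The quotient `g` is built by synthetic division along the Horner form.
  factor : ∀ {k f} → Monic (suc k) f → ∀ r →
           ∃ λ g → Monic k g × (∀ x → f x + r * g x ≈ f r + x * g x)
  factor {zero}  {f} (horner {g = h} b f≈ (one h≈1)) r = (λ _ → 1#) , one (λ _ → refl) , λ x → begin
    f x + r * 1#             ≈⟨ +-cong (f≈ x) (*-congˡ (sym (h≈1 r))) ⟩
    b + x * h x + r * h r    ≈⟨ xy∙z≈xz∙y _ _ _ ⟩
    b + r * h r + x * h x    ≈⟨ +-cong (sym (f≈ r)) (*-congˡ (h≈1 x)) ⟩
    f r + x * 1#             ∎
    where
    open Algebra.Properties.CommutativeSemigroup
      (CommutativeMonoid.commutativeSemigroup +-commutativeMonoid) using (xy∙z≈xz∙y)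
  factor {suc k} {f} (horner {g = h} b f≈ hMonic) r with g , gMonic , h≈ ← factor hMonic r =
    (λ x → h r + x * g x) , horner (h r) (λ _ → refl) gMonic , λ x → begin
      f x + r * (h r + x * g x)         ≈⟨ +-cong (f≈ x) (distribˡ r _ _) ⟩
      (b + x * h x) + (r * h r + r * (x * g x))
        ≈⟨ solve 6 (λ b x r hx hr gx → (b :+ x :* hx) :+ (r :* hr :+ r :* (x :* gx))
                                     := (b :+ r :* hr) :+ x :* (hx :+ r :* gx)) refl b x r (h x) (h r) (g x) ⟩
      (b + r * h r) + x * (h x + r * g x)
        ≈⟨ +-cong (sym (f≈ r)) (*-congˡ (h≈ x)) ⟩
      f r + x * (h r + x * g x)         ∎

  monic-^-id : ∀ {k} → 1 < k → Monic k (λ x → x ^ k - x)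
  monic-^-id {suc zero} (s≤s ())
  monic-^-id {suc (suc k)} _ = horner 0# eq (horner (- 1#) (λ _ → refl) (monic-power k))
    where
    eq : ∀ x → x ^ suc (suc k) - x ≈ 0# + x * (- 1# + x * x ^ k)
    eq x = begin
      x * (x * x ^ k) - x               ≈⟨ +-comm _ _ ⟩
      - x + x * (x * x ^ k)             ≈⟨ +-congʳ (trans (sym (-1*x≈-x x)) (*-comm _ _)) ⟩
      x * - 1# + x * (x * x ^ k)        ≈⟨ distribˡ x _ _ ⟨
      x * (- 1# + x * x ^ k)            ≈⟨ +-identityˡ _ ⟨
      0# + x * (- 1# + x * x ^ k)       ∎

  -- Dividing by the linear factor of the first root lowers the degree by one. The other roots
  -- survive: where the quotient is nonzero it could be cancelled, which would identify that root
  -- with the first.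
  noMoreRootsThanDegree : ∀ {k f} → Monic k f → (r : Vector Carrier (suc k)) →
                          (∀ {i j} → r i ≈ r j → i ≡ j) → ¬ (∀ i → f (r i) ≈ 0#)
  noMoreRootsThanDegree {zero} (one f≈1) r r-injective root =
    1≉0 (trans (sym (f≈1 (r zero))) (root zero))
  noMoreRootsThanDegree {suc k} {f} fMonic r r-injective root
    with g , gMonic , f≈ ← factor fMonic (r zero) =
    noMoreRootsThanDegree gMonic (r ∘ suc) (suc-injective ∘ r-injective) rootOfFactor
    where
    rootOfFactor : ∀ i → g (r (suc i)) ≈ 0#
    rootOfFactor i with g (r (suc i)) ≟ 0#
    ... | yes gr≈0 = gr≈0
    ... | no  gr≉0 = contradiction (r-injective (*-cancelˡ-nonZero gr≉0 (begin
      g (r (suc i)) * r zero               ≈⟨ *-comm _ _ ⟩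
      r zero * g (r (suc i))               ≈⟨ +-identityˡ _ ⟨
      0# + r zero * g (r (suc i))          ≈⟨ +-congʳ (root (suc i)) ⟨
      f (r (suc i)) + r zero * g (r (suc i)) ≈⟨ f≈ (r (suc i)) ⟩
      f (r zero) + r (suc i) * g (r (suc i)) ≈⟨ +-congʳ (root zero) ⟩
      0# + r (suc i) * g (r (suc i))       ≈⟨ +-identityˡ _ ⟩
      r (suc i) * g (r (suc i))            ≈⟨ *-comm _ _ ⟩
      g (r (suc i)) * r (suc i)            ∎))) λ ()

-- Linear maps and linear combinations

module _ {r ℓr m ℓm n ℓn} {R : Ring r ℓr} (M : LeftModule R m ℓm) (N : LeftModule R n ℓn) where
  private
    module R = Ring R
    module M = LeftModule M
    module N = LeftModule N
    open Algebra.Properties.Group N.+ᴹ-group using () renaming (∙-cancelʳ to +ᴹ-cancelʳ)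

  record IsLinear (f : M.Carrierᴹ → N.Carrierᴹ) : Set (r ⊔ m ⊔ ℓm ⊔ ℓn) where
    field
      cong    : ∀ {x y} → x M.≈ᴹ y → f x N.≈ᴹ f y
      +ᴹ-homo : ∀ x y → f (x M.+ᴹ y) N.≈ᴹ (f x N.+ᴹ f y)
      *ₗ-homo : ∀ a x → f (a M.*ₗ x) N.≈ᴹ (a N.*ₗ f x)

    0ᴹ-homo : f M.0ᴹ N.≈ᴹ N.0ᴹ
    0ᴹ-homo = N.≈ᴹ-trans (cong (M.≈ᴹ-sym (M.*ₗ-zeroˡ M.0ᴹ)))
      (N.≈ᴹ-trans (*ₗ-homo R.0# M.0ᴹ) (N.*ₗ-zeroˡ _))

    difference-kernel : ∀ x y → f x N.≈ᴹ f y → f (x M.+ᴹ (M.-ᴹ y)) N.≈ᴹ N.0ᴹ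
    difference-kernel x y fx≈fy = +ᴹ-cancelʳ (f y) _ _
      (N.≈ᴹ-trans (N.≈ᴹ-sym (+ᴹ-homo _ _))
        (N.≈ᴹ-trans (cong (M.≈ᴹ-trans (M.+ᴹ-assoc _ _ _)
                      (M.≈ᴹ-trans (M.+ᴹ-congˡ (M.-ᴹ‿inverseˡ y)) (M.+ᴹ-identityʳ x))))
          (N.≈ᴹ-trans fx≈fy (N.≈ᴹ-sym (N.+ᴹ-identityˡ _)))))

    combination-homo : ∀ {k} a (v : Vector M.Carrierᴹ k) →
      f (LinearAlgebra.combination M a v) N.≈ᴹ LinearAlgebra.combination N a (f ∘ v)
    combination-homo {zero}  a v = 0ᴹ-homo
    combination-homo {suc k} a v = N.≈ᴹ-trans (+ᴹ-homo _ _)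
      (N.+ᴹ-cong (*ₗ-homo (a zero) (v zero)) (combination-homo (a ∘ suc) (v ∘ suc)))

module Combinations {r ℓr m ℓm} {R : Ring r ℓr} (M : LeftModule R m ℓm) where
  open Ring R using (Carrier; _≈_; 0#; 1#; _-_)
  private module R = Ring R
  open LeftModule M
  open LinearAlgebra M
  open Algebra.Properties.CommutativeMonoid.Sum +ᴹ-commutativeMonoid
  open Algebra.Properties.Group R.+-group using (x∙y⁻¹≈ε⇒x≈y)
  open Relation.Binary.Reasoning.Setoid ≈ᴹ-setoid

  combination-cong : ∀ {n} {a b : Vector Carrier n} {v w : Vector Carrierᴹ n} →
    (∀ i → a i ≈ b i) → (∀ i → v i ≈ᴹ w i) → combination a v ≈ᴹ combination b w
  combination-cong a≈b v≈w = sum-cong-≋ (λ i → *ₗ-cong (a≈b i) (v≈w i))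

  combination-zero : ∀ {n} (a : Vector Carrier n) {v : Vector Carrierᴹ n} →
    (∀ i → v i ≈ᴹ 0ᴹ) → combination a v ≈ᴹ 0ᴹ
  combination-zero {n} a v≈0 = ≈ᴹ-trans
    (sum-cong-≋ {n} (λ i → ≈ᴹ-trans (*ₗ-cong R.refl (v≈0 i)) (*ₗ-zeroʳ (a i)))) (sum-replicate-zero n)

  combination-linear : ∀ {n} (v : Vector Carrierᴹ n) →
    IsLinear (power regular n) M (λ a → combination a v)
  combination-linear v = record
    { cong    = λ a≈b → combination-cong a≈b (λ _ → ≈ᴹ-refl)
    ; +ᴹ-homo = λ a b → ≈ᴹ-trans (sum-cong-≋ (λ i → *ₗ-distribʳ (v i) (a i) (b i)))
                          (∑-distrib-+ (λ i → a i *ₗ v i) (λ i → b i *ₗ v i))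
    ; *ₗ-homo = λ a b → scale a b v
    }
    where
    scale : ∀ {n} a b (v : Vector Carrierᴹ n) → combination (λ i → a R.* b i) v ≈ᴹ a *ₗ combination b v
    scale {zero}  a b v = ≈ᴹ-sym (*ₗ-zeroʳ a)
    scale {suc n} a b v = ≈ᴹ-trans (+ᴹ-cong (*ₗ-assoc a (b zero) (v zero)) (scale a (b ∘ suc) (v ∘ suc)))
      (≈ᴹ-sym (*ₗ-distribˡ a _ _))

  unit : ∀ {n} → Fin n → Vector Carrier n
  unit zero    = 1# ∷ λ _ → 0#
  unit (suc i) = 0# ∷ unit i

  unit-diagonal : ∀ {n} (i : Fin n) → unit i i ≈ 1#
  unit-diagonal zero    = R.refl
  unit-diagonal (suc i) = unit-diagonal i

  combination-unit : ∀ {n} i (v : Vector Carrierᴹ n) → combination (unit i) v ≈ᴹ v i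
  combination-unit zero v = begin
    1# *ₗ v zero +ᴹ combination (λ _ → 0#) (v ∘ suc)
      ≈⟨ +ᴹ-cong (*ₗ-identityˡ _) (IsLinear.0ᴹ-homo (combination-linear (v ∘ suc))) ⟩
    v zero +ᴹ 0ᴹ     ≈⟨ +ᴹ-identityʳ _ ⟩
    v zero           ∎
  combination-unit (suc i) v = begin
    0# *ₗ v zero +ᴹ combination (unit i) (v ∘ suc)
      ≈⟨ +ᴹ-cong (*ₗ-zeroˡ _) (combination-unit i (v ∘ suc)) ⟩
    0ᴹ +ᴹ v (suc i)  ≈⟨ +ᴹ-identityˡ _ ⟩
    v (suc i)        ∎

  combination-++ : ∀ {k n} a (v : Vector Carrierᴹ k) (w : Vector Carrierᴹ n) →
    combination a (v ++ w) ≈ᴹ combination (a ∘ (_↑ˡ n)) v +ᴹ combination (a ∘ (k ↑ʳ_)) w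
  combination-++ {zero}      a v w = ≈ᴹ-sym (+ᴹ-identityˡ _)
  combination-++ {suc k} {n} a v w = begin
    a zero *ₗ v zero +ᴹ combination (a ∘ suc) ((v ++ w) ∘ suc)
      ≈⟨ +ᴹ-congˡ (combination-cong {v = (v ++ w) ∘ suc} (λ _ → R.refl)
           (λ i → ≈ᴹ-reflexive ([,]-map (splitAt k i)))) ⟩
    a zero *ₗ v zero +ᴹ combination (a ∘ suc) ((v ∘ suc) ++ w)
      ≈⟨ +ᴹ-congˡ (combination-++ (a ∘ suc) (v ∘ suc) w) ⟩
    a zero *ₗ v zero +ᴹ (combination (λ i → a (suc (i ↑ˡ n))) (v ∘ suc) +ᴹ combination (λ i → a (suc (k ↑ʳ i))) w)
      ≈⟨ +ᴹ-assoc _ _ _ ⟨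
    combination (a ∘ (_↑ˡ n)) v +ᴹ combination (a ∘ (suc k ↑ʳ_)) w
      ∎

  independent-injective : ∀ {n} {v : Vector Carrierᴹ n} → LinearlyIndependent v →
    ∀ a b → combination a v ≈ᴹ combination b v → ∀ i → a i ≈ b i
  independent-injective {v = v} independent a b eq i =
    x∙y⁻¹≈ε⇒x≈y (a i) (b i)
      (independent (λ j → a j - b j)
        (IsLinear.difference-kernel (combination-linear v) a b eq) i)

  Span-isSubspace : ∀ {n} (v : Vector Carrierᴹ n) → IsSubspace (Span v)
  Span-isSubspace v = record
    { resp      = λ x≈y (a , eq) → a , ≈ᴹ-trans (≈ᴹ-sym x≈y) eq
    ; 0-closed  = (λ _ → 0#) , ≈ᴹ-sym (IsLinear.0ᴹ-homo linear)
    ; +-closed  = λ (a , eq₁) (b , eq₂) → (λ i → a i R.+ b i) ,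
        ≈ᴹ-trans (+ᴹ-cong eq₁ eq₂) (≈ᴹ-sym (IsLinear.+ᴹ-homo linear a b))
    ; *ₗ-closed = λ s (a , eq) → (λ i → s R.* a i) ,
        ≈ᴹ-trans (*ₗ-cong R.refl eq) (≈ᴹ-sym (IsLinear.*ₗ-homo linear s a))
    }
    where linear = combination-linear v

  member-Span : ∀ {n} (v : Vector Carrierᴹ n) i → v i ∈ Span v
  member-Span v i = unit i , ≈ᴹ-sym (combination-unit i v)

  evaluation-linear : ∀ {n} (i : Fin n) → IsLinear (power M n) M (λ v → v i)
  evaluation-linear i = record
    { cong = λ p → p i ; +ᴹ-homo = λ _ _ → ≈ᴹ-refl ; *ₗ-homo = λ _ _ → ≈ᴹ-refl }

module _ {c ℓ a} (F : HeytingField c ℓ a) where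
  open CommutativeRing (fieldCommutativeRing F) hiding (zero)
  open LinearAlgebra {R = fieldRing F} regular
  open Combinations {R = fieldRing F} regular

  combination-comm : ∀ {n} (a b : Vector Carrier n) → combination a b ≈ combination b a
  combination-comm {zero}  a b = refl
  combination-comm {suc n} a b = +-cong (*-comm _ _) (combination-comm (a ∘ suc) (b ∘ suc))

  combination-linearʳ : ∀ {n} (a : Vector Carrier n) →
    IsLinear (coordinateSpace F n) regular (combination a)
  combination-linearʳ a = record
    { cong    = combination-cong (λ _ → refl)
    ; +ᴹ-homo = λ v w → trans (combination-comm a _)
        (trans (L.+ᴹ-homo v w) (+-cong (combination-comm v a) (combination-comm w a)))
    ; *ₗ-homo = λ s v → trans (combination-comm a _)
        (trans (L.*ₗ-homo s v) (*-congˡ (combination-comm v a)))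
    }
    where module L = IsLinear (combination-linear a)

-- Extensions of finite fields

-- The degree `m` enters through cardinality alone: `K` has `q ^ m` elements and `Fⁿ` has `q ^ n`.
module ExtensionProperties {c ℓ a c′ ℓ′ a′} {F : HeytingField c ℓ a} {K : HeytingField c′ ℓ′ a′}
  (E : Extension F K) {q m : ℕ} (orderF : HasOrder F q) (orderK : HasOrder K (q ^ℕ m)) where

  module F where
    open CommutativeRing (fieldCommutativeRing F) hiding (zero) public
    open FiniteField F orderF public
    open Algebra.Properties.CommutativeSemiring.Exp commutativeSemiring public
  module K where
    open CommutativeRing (fieldCommutativeRing K) hiding (zero) public
    open FiniteField K orderK public
    open Algebra.Properties.CommutativeSemiring.Exp commutativeSemiring public
  open Extension E

  embed-^ : ∀ x k → embed (x F.^ k) K.≈ embed x K.^ k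
  embed-^ x zero    = 1#-homo
  embed-^ x (suc k) = K.trans (*-homo x (x F.^ k)) (K.*-congˡ (embed-^ x k))

  frobenius-fixes-embed : ∀ x → embed x K.^ q K.≈ embed x
  frobenius-fixes-embed x = K.trans (K.sym (embed-^ x q)) (⟦⟧-cong (F.^-order x))

  -- The `q` elements of `F` are already roots of X^q - X, so a fixed element outside `F` would be
  -- one root too many.
  frobenius-fixed : ∀ {w} → w K.^ q K.≈ w → ∃ λ x → embed x K.≈ w
  frobenius-fixed {w} fixed
    with F.exists? (λ p eq → K.trans (⟦⟧-cong (F.sym p)) eq) (λ x → embed x K.≟ w)
  ... | yes found = found
  ... | no ¬found = contradiction root
        (K.noMoreRootsThanDegree (K.monic-^-id F.1<order) roots distinct)
    where
    roots : Vector K.Carrier (suc q)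
    roots = w ∷ (embed ∘ F.element)
    distinct : ∀ {i j} → roots i K.≈ roots j → i ≡ j
    distinct {zero}  {zero}  _  = ≡.refl
    distinct {zero}  {suc j} eq = contradiction (F.element j , K.sym eq) ¬found
    distinct {suc i} {zero}  eq = contradiction (F.element i , eq) ¬found
    distinct {suc i} {suc j} eq = ≡.cong suc
      (≡.trans (≡.sym (F.strictlyInverseˡ i)) (≡.trans (F.index-cong (injective eq)) (F.strictlyInverseˡ j)))
    open Algebra.Properties.Group K.+-group using (x≈y⇒x∙y⁻¹≈ε)
    root : ∀ i → roots i K.^ q K.- roots i K.≈ K.0#
    root zero    = x≈y⇒x∙y⁻¹≈ε fixed
    root (suc i) = x≈y⇒x∙y⁻¹≈ε (frobenius-fixes-embed (F.element i))

  K/F : LeftModule (fieldRing F) c′ ℓ′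
  K/F = restrictScalars E regular

  open LinearAlgebra K/F
  open Combinations K/F

  private
    vector : ∀ n → Fin (q ^ℕ n) → Vector F.Carrier n
    vector n i = F.element ∘ finToFun i

    index : ∀ {n} → Vector F.Carrier n → Fin (q ^ℕ n)
    index a = funToFin (F.index ∘ a)

    vector-index : ∀ {n} (a : Vector F.Carrier n) j → vector _ (index a) j F.≈ a j
    vector-index a j = F.trans (F.from-cong (finToFun-funToFin (F.index ∘ a) j)) (F.strictlyInverseʳ (a j))

    vector-injective : ∀ {n} (i j : Fin (q ^ℕ n)) → (∀ k → vector n i k F.≈ vector n j k) → i ≡ j
    vector-injective {n} i j eq = ≡.trans (≡.sym (funToFin-finToFin {n} {q} i))
      (≡.trans (funToFin-cong {n} {q} λ k → ≡.trans (≡.sym (F.strictlyInverseˡ _))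
                                      (≡.trans (F.index-cong (eq k)) (F.strictlyInverseˡ _)))
        (funToFin-finToFin {n} {q} j))
      where
      funToFin-cong : ∀ {n k} {f g : Fin n → Fin k} → (∀ i → f i ≡ g i) → funToFin f ≡ funToFin g
      funToFin-cong {zero}  _   = ≡.refl
      funToFin-cong {suc n} f≗g = ≡.cong₂ combine (f≗g zero) (funToFin-cong (f≗g ∘ suc))

    combination-vector-index : ∀ {n} (a : Vector F.Carrier n) v →
                              combination (vector _ (index a)) v K.≈ combination a v
    combination-vector-index a v = IsLinear.cong (combination-linear v) (vector-index a)

  inSpan? : ∀ {n} (v : Vector K.Carrier n) x → Dec (Span v x)
  inSpan? {n} v x = Dec.map′ (λ (i , eq) → vector n i , eq)
    (λ (a , eq) → index a , K.trans eq (K.sym (combination-vector-index a v)))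
    (any? (λ i → x K.≟ combination (vector n i) v))

  -- If `v` spanned `K`, a choice of coordinates would inject `q ^ m` elements into `q ^ n`
  -- coefficient vectors.
  ∃-∉Span : ∀ {n} → n < m → (v : Vector K.Carrier n) → ∃ λ x → ¬ Span v x
  ∃-∉Span {n} n<m v
    with any? (λ i → Dec.¬? (inSpan? v (K.element i)))
  ... | yes (i , ∉) = K.element i , ∉
  ... | no all∈ = contradiction (ℕ.^-monoʳ-< q F.1<order n<m) (ℕ.≤⇒≯ (injective⇒≤ f-injective))
    where
    coordinates : ∀ i → Span v (K.element i)
    coordinates i = Dec.decidable-stable (inSpan? v (K.element i)) (λ ∉ → all∈ (i , ∉))
    f : Fin (q ^ℕ m) → Fin (q ^ℕ n)
    f i = index (proj₁ (coordinates i))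
    f-injective : ∀ {i j} → f i ≡ f j → i ≡ j
    f-injective {i} {j} eq = ≡.trans (≡.sym (K.strictlyInverseˡ i)) (≡.trans (K.index-cong (begin
      K.element i                               ≈⟨ proj₂ (coordinates i) ⟩
      combination (proj₁ (coordinates i)) v     ≈⟨ combination-vector-index (proj₁ (coordinates i)) v ⟨
      combination (vector n (f i)) v            ≡⟨ ≡.cong (λ k → combination (vector n k) v) eq ⟩
      combination (vector n (f j)) v            ≈⟨ combination-vector-index (proj₁ (coordinates j)) v ⟩
      combination (proj₁ (coordinates j)) v     ≈⟨ proj₂ (coordinates j) ⟨
      K.element j                               ∎)) (K.strictlyInverseˡ j))
      where open Relation.Binary.Reasoning.Setoid K.setoid

  ∷-independent : ∀ {n x} {v : Vector K.Carrier n} → ¬ Span v x → LinearlyIndependent v →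
                  LinearlyIndependent (x ∷ v)
  ∷-independent {x = x} {v} ∉ independent b eq with b zero F.≟ F.0#
  ... | no b₀≉0 with b₀⁻¹ , b₀b₀⁻¹≈1 ← F.inverse b₀≉0 =
    contradiction (resp (K.sym x≈) (*ₗ-closed (F.- b₀⁻¹) (b ∘ suc , K.refl))) ∉
    where
    open Relation.Binary.Reasoning.Setoid K.setoid
    open Algebra.Properties.Ring K.ring using (-‿distribˡ-*; -‿distribʳ-*; +-inverseˡ-unique)
    open IsSubspace (Span-isSubspace v)
    C = combination (b ∘ suc) v
    x≈ : x K.≈ embed (F.- b₀⁻¹) K.* C
    x≈ = begin
      x                                     ≈⟨ LeftModule.*ₗ-identityˡ K/F x ⟨
      embed F.1# K.* x                      ≈⟨ K.*-congʳ (⟦⟧-cong (F.trans (F.*-comm _ _) b₀b₀⁻¹≈1)) ⟨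
      embed (b₀⁻¹ F.* b zero) K.* x         ≈⟨ LeftModule.*ₗ-assoc K/F b₀⁻¹ (b zero) x ⟩
      embed b₀⁻¹ K.* (embed (b zero) K.* x) ≈⟨ K.*-congˡ (+-inverseˡ-unique _ _ eq) ⟩
      embed b₀⁻¹ K.* (K.- C)                ≈⟨ -‿distribʳ-* _ _ ⟨
      K.- (embed b₀⁻¹ K.* C)                ≈⟨ -‿distribˡ-* _ _ ⟩
      (K.- embed b₀⁻¹) K.* C                ≈⟨ K.*-congʳ (-‿homo b₀⁻¹) ⟨
      embed (F.- b₀⁻¹) K.* C                ∎
  ... | yes b₀≈0 = λ where
      zero    → b₀≈0
      (suc i) → independent (b ∘ suc) (begin
        combination (b ∘ suc) v                       ≈⟨ K.+-identityˡ _ ⟨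
        K.0# K.+ combination (b ∘ suc) v              ≈⟨ K.+-congʳ (LeftModule.*ₗ-zeroˡ K/F x) ⟨
        embed F.0# K.* x K.+ combination (b ∘ suc) v  ≈⟨ K.+-congʳ (K.*-congʳ (⟦⟧-cong b₀≈0)) ⟨
        combination b (x ∷ v)                         ≈⟨ eq ⟩
        K.0#                                          ∎) i
    where open Relation.Binary.Reasoning.Setoid K.setoid

  independentFamily : ∀ n → n ≤ m → ∃ λ (v : Vector K.Carrier n) → LinearlyIndependent v
  independentFamily zero    _   = [] , λ _ _ ()
  independentFamily (suc n) n<m with v , independent ← independentFamily n (ℕ.<⇒≤ n<m)
    with x , ∉ ← ∃-∉Span n<m v = x ∷ v , ∷-independent ∉ independent

  -- The value of `f` together with two coordinates takes at most `q ^ (m + 2)` values, fewer than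
  -- there are vectors. Two distinct vectors therefore agree on all three, and their difference is
  -- as required.
  nonZeroKernelVector : ∀ {n f} → m +ℕ 2 < n → IsLinear (coordinateSpace F n) K/F f → ∀ i j →
           ∃ λ a → f a K.≈ K.0# × a i F.≈ F.0# × a j F.≈ F.0# × ∃ λ k → ¬ a k F.≈ F.0#
  nonZeroKernelVector {n} {f} m+2<n linear i j =
    let s , t , s<t , eq = pigeonhole few observe
        fₛ≡fₜ , rest = combine-injective (K.index (f (vector n s))) _ _ _ eq
        sᵢ≡tᵢ , sⱼ≡tⱼ = combine-injective (F.index (vector n s i)) _ _ _ rest
    in (λ l → vector n s l F.- vector n t l)
     , IsLinear.difference-kernel linear (vector n s) (vector n t) (K.index-injective fₛ≡fₜ)
     , x≈y⇒x∙y⁻¹≈ε (F.index-injective sᵢ≡tᵢ)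
     , x≈y⇒x∙y⁻¹≈ε (F.index-injective sⱼ≡tⱼ)
     , ¬∀⟶∃¬ _ _ (λ l → vector n s l F.- vector n t l F.≟ F.0#)
         (λ all≈0 → <⇒≢ s<t (vector-injective {n} s t (λ l → x∙y⁻¹≈ε⇒x≈y _ _ (all≈0 l))))
    where
    open Algebra.Properties.Group F.+-group using (x∙y⁻¹≈ε⇒x≈y; x≈y⇒x∙y⁻¹≈ε)
    observe : Fin (q ^ℕ n) → Fin (q ^ℕ m *ℕ (q *ℕ q))
    observe s = combine (K.index (f (vector n s))) (combine (F.index (vector n s i)) (F.index (vector n s j)))
    few : q ^ℕ m *ℕ (q *ℕ q) < q ^ℕ n
    few = ≡.subst (_< q ^ℕ n)
      (≡.trans (ℕ.^-distribˡ-+-* q m 2) (≡.cong (λ k → q ^ℕ m *ℕ (q *ℕ k)) (ℕ.*-identityʳ q)))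
      (ℕ.^-monoʳ-< q F.1<order m+2<n)

-- Rank-metric codes

module _ {c ℓ a} (K : HeytingField c ℓ a) {l k : ℕ} (G : Vector (Vector (HeytingField.Carrier K) l) k) where
  open LinearAlgebra (coordinateSpace K l)
  open Combinations (coordinateSpace K l)

  rowSpace : 1 ≤ k → LinearlyIndependent G → Code K (c ⊔ ℓ) l k
  rowSpace 1≤k independent = record
    { 1≤k        = 1≤k
    ; Codeword   = Span G
    ; isSubspace = Span-isSubspace G
    ; dimension  = G , record
        { member = member-Span G ; independent = independent ; spanning = λ x∈ → x∈ }
    }

module _ {c ℓ a c′ ℓ′ a′} {F : HeytingField c ℓ a} {K : HeytingField c′ ℓ′ a′} (E : Extension F K) where
  private
    module F = CommutativeRing (fieldCommutativeRing F)
    module K = CommutativeRing (fieldCommutativeRing K)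
    module LK/F = LinearAlgebra (restrictScalars E regular)
    module CK/F = Combinations (restrictScalars E regular)
  open Extension E

  -- Since `β` is independent, `b` annihilates `v` only if it annihilates every column of the matrix
  -- of `v`, hence their span. The columns of the matrix of `v′` lie in that span.
  rankSupport-annihilator : ∀ {m l} (Γ : OrderedBasis E m) (v v′ : Vector K.Carrier l) →
    rankSupport E Γ v′ ⊆ rankSupport E Γ v →
    ∀ b → LK/F.combination b v K.≈ K.0# → LK/F.combination b v′ K.≈ K.0#
  rankSupport-annihilator {m} {l} Γ@(β , isBasis) v v′ v′⊆v b b⊥v = begin
    LK/F.combination b v′                       ≈⟨ expand v′ ⟩
    LK/F.combination (columnSums v′) β          ≈⟨ IsLinear.cong β-linear columnSums′≈0 ⟩
    LK/F.combination (λ _ → F.0#) β             ≈⟨ IsLinear.0ᴹ-homo β-linear ⟩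
    K.0#                                        ∎
    where
    open Relation.Binary.Reasoning.Setoid K.setoid
    module CF = Combinations {R = fieldRing F} regular
    module CFˡ = Combinations (coordinateSpace F l)
    open LinearAlgebra {R = fieldRing F} regular using (combination)
    β-linear = CK/F.combination-linear β
    columnSums : Vector K.Carrier l → Vector F.Carrier m
    columnSums w j = combination b (λ i → expansion E Γ w i j)

    expand : ∀ w → LK/F.combination b w K.≈ LK/F.combination (columnSums w) β
    expand w = begin
      LK/F.combination b w
        ≈⟨ CK/F.combination-cong (λ _ → F.refl) (λ i → proj₂ (LK/F.IsBasisOf.spanning isBasis {x = w i} _)) ⟩
      LK/F.combination b (λ i → LK/F.combination (expansion E Γ w i) β)
        ≈⟨ IsLinear.combination-homo β-linear b (expansion E Γ w) ⟨
      LK/F.combination (LinearAlgebra.combination (coordinateSpace F m) b (expansion E Γ w)) β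
        ≈⟨ IsLinear.cong β-linear (λ j → IsLinear.combination-homo (CF.evaluation-linear j) b (expansion E Γ w)) ⟩
      LK/F.combination (columnSums w) β ∎

    columnSums≈0 : ∀ j → columnSums v j F.≈ F.0#
    columnSums≈0 = LK/F.IsBasisOf.independent isBasis (columnSums v) (K.trans (K.sym (expand v)) b⊥v)

    columnSums′≈0 : ∀ j → columnSums v′ j F.≈ F.0#
    columnSums′≈0 j with d , eq ← v′⊆v (CFˡ.member-Span (λ j i → expansion E Γ v′ i j) j) =
      F.trans (IsLinear.cong b-linear eq)
        (F.trans (IsLinear.combination-homo b-linear d (λ j i → expansion E Γ v i j))
          (CF.combination-zero d columnSums≈0))
      where b-linear = combination-linearʳ F b

-- Proportionality of vectors over a finite field

module FieldProportionality {c ℓ a} (K : HeytingField c ℓ a) {n} (order : HasOrder K n) where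
  open CommutativeRing (fieldCommutativeRing K) hiding (zero)
  open FiniteField K order
  open Relation.Binary.Reasoning.Setoid setoid
  open Algebra.Solver.Ring.NaturalCoefficients.Default commutativeSemiring
    using (solve; _:+_; _:*_; _:=_)
  open Algebra.Properties.Ring ring using (+-cancelˡ; +-cancelʳ)

  sharedKernel⇒det≈0 : ∀ {x₀ x₁ y₀ y₁ s t} → ¬ (s ≈ 0# × t ≈ 0#) →
    x₀ * s + x₁ * t ≈ 0# → y₀ * s + y₁ * t ≈ 0# → x₀ * y₁ ≈ x₁ * y₀
  sharedKernel⇒det≈0 {x₀} {x₁} {y₀} {y₁} {s} {t} ≉0 x⊥ y⊥ with s ≟ 0# | t ≟ 0#
  ... | yes s≈0 | yes t≈0 = contradiction (s≈0 , t≈0) ≉0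
  -- Adding `x₁ * y₁ * t` turns both sides into multiples of the two vanishing forms; the other case
  -- is symmetric.
  ... | no s≉0  | _ = *-cancelˡ-nonZero s≉0 (+-cancelʳ (x₁ * y₁ * t) _ _ (begin
    s * (x₀ * y₁) + x₁ * y₁ * t
      ≈⟨ solve 5 (λ s t x₀ x₁ y₁ → s :* (x₀ :* y₁) :+ x₁ :* y₁ :* t := y₁ :* (x₀ :* s :+ x₁ :* t)) refl s t x₀ x₁ y₁ ⟩
    y₁ * (x₀ * s + x₁ * t)   ≈⟨ trans (*-congˡ x⊥) (zeroʳ _) ⟩
    0#                       ≈⟨ trans (*-congˡ y⊥) (zeroʳ _) ⟨
    x₁ * (y₀ * s + y₁ * t)
      ≈⟨ solve 5 (λ s t x₁ y₀ y₁ → x₁ :* (y₀ :* s :+ y₁ :* t) := s :* (x₁ :* y₀) :+ x₁ :* y₁ :* t) refl s t x₁ y₀ y₁ ⟩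
    s * (x₁ * y₀) + x₁ * y₁ * t ∎))
  ... | yes _   | no t≉0 = *-cancelˡ-nonZero t≉0 (+-cancelˡ (x₀ * y₀ * s) _ _ (begin
    x₀ * y₀ * s + t * (x₀ * y₁)
      ≈⟨ solve 5 (λ s t x₀ y₀ y₁ → x₀ :* y₀ :* s :+ t :* (x₀ :* y₁) := x₀ :* (y₀ :* s :+ y₁ :* t)) refl s t x₀ y₀ y₁ ⟩
    x₀ * (y₀ * s + y₁ * t)   ≈⟨ trans (*-congˡ y⊥) (zeroʳ _) ⟩
    0#                       ≈⟨ trans (*-congˡ x⊥) (zeroʳ _) ⟨
    y₀ * (x₀ * s + x₁ * t)
      ≈⟨ solve 5 (λ s t x₀ x₁ y₀ → y₀ :* (x₀ :* s :+ x₁ :* t) := x₀ :* y₀ :* s :+ t :* (x₁ :* y₀)) refl s t x₀ x₁ y₀ ⟩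
    x₀ * y₀ * s + t * (x₁ * y₀) ∎))

  minors≈0⇒multiple : ∀ {k} (x y : Vector Carrier k) {i} → ¬ x i ≈ 0# →
    (∀ j → x i * y j ≈ x j * y i) → ∃ λ α → ∀ j → y j ≈ α * x j
  minors≈0⇒multiple x y {i} xᵢ≉0 minors with xᵢ⁻¹ , inv ← inverse xᵢ≉0 =
    y i * xᵢ⁻¹ , λ j → *-cancelˡ-nonZero xᵢ≉0 (begin
      x i * y j                  ≈⟨ minors j ⟩
      x j * y i                  ≈⟨ *-identityˡ _ ⟨
      1# * (x j * y i)           ≈⟨ *-congʳ inv ⟨
      x i * xᵢ⁻¹ * (x j * y i)
        ≈⟨ solve 4 (λ xi xi⁻¹ xj yi → xi :* xi⁻¹ :* (xj :* yi) := xi :* (yi :* xi⁻¹ :* xj)) refl (x i) xᵢ⁻¹ (x j) (y i) ⟩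
      x i * (y i * xᵢ⁻¹ * x j)   ∎)

-- The generator matrix and its columns

module Construction {c ℓ a c′ ℓ′ a′} {F : HeytingField c ℓ a} {K : HeytingField c′ ℓ′ a′}
  (E : Extension F K) {q m : ℕ} (orderF : HasOrder F q) (orderK : HasOrder K (q ^ℕ m))
  (primePower : IsPrimePower q) (2≤m : 2 ≤ m) where

  open ExtensionProperties E {m = m} orderF orderK
  open Extension E
  open LinearAlgebra K/F
  open Combinations K/F
  open Relation.Binary.Reasoning.Setoid K.setoid
  private
    module LK = LinearAlgebra {R = fieldRing K} regular
    module CK = Combinations {R = fieldRing K} regular

  -- Additivity holds because `K` has `p ^ (e * m)` elements, hence characteristic `p`, and
  -- `q = p ^ e`. Scalars pass through because the map fixes `F`.
  frobenius-linear : IsLinear K/F K/F (K._^ q)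
  frobenius-linear = record
    { cong    = K.^-congˡ q
    ; +ᴹ-homo = additive
    ; *ₗ-homo = λ x z → K.trans (K.^-distrib-* (embed x) z q) (K.*-congʳ (frobenius-fixes-embed x))
    }
    where
    additive : ∀ x y → (x K.+ y) K.^ q K.≈ x K.^ q K.+ y K.^ q
    additive = let p , e , p-prime , _ , q≡p^e = primePower in ≡.subst
      (λ n → ∀ x y → (x K.+ y) K.^ n K.≈ x K.^ n K.+ y K.^ n) (≡.sym q≡p^e)
      (Frobenius.^[p^e]-distrib-+ K.commutativeSemiring p-prime
        (K.characteristic {p} {e *ℕ m} (≡.trans (≡.cong (_^ℕ m) q≡p^e) (ℕ.^-*-assoc p e m))) e)

  abstract
    -- An `F`-basis of `K`, by cardinality, so that z ranges over all of `K`. The pair `ε` spans B.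
    -- Only their independence is visible outside this block.
    ω : Vector K.Carrier m
    ω = proj₁ (independentFamily m ℕ.≤-refl)
    ω-independent : LinearlyIndependent ω
    ω-independent = proj₂ (independentFamily m ℕ.≤-refl)
    ε : Vector K.Carrier 2
    ε = proj₁ (independentFamily 2 2≤m)
    ε-independent : LinearlyIndependent ε
    ε-independent = proj₂ (independentFamily 2 2≤m)

  -- The first `m` coefficients of an `F`-combination of the columns are those of z, the next one is
  -- a, and the last two are those of b in terms of `ε`.
  rows : Vector (Vector K.Carrier (m +ℕ 3)) 3
  rows = (ω ++ λ _ → K.0#)
       ∷ ((λ i → ω i K.^ q) ++ (K.1# ∷ λ _ → K.0#))
       ∷ ((λ _ → K.0#) ++ (K.0# ∷ ε))
       ∷ []

  columns : Vector (Vector K.Carrier 3) (m +ℕ 3)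
  columns j i = rows i j

  point : Vector F.Carrier (m +ℕ 3) → Vector K.Carrier 3
  point b i = combination b (rows i)

  zPart : Vector F.Carrier (m +ℕ 3) → K.Carrier
  zPart b = combination (b ∘ (_↑ˡ 3)) ω

  aIndex : Fin (m +ℕ 3)
  aIndex = m ↑ʳ 0F

  point₀ : ∀ b → point b 0F K.≈ zPart b
  point₀ b = begin
    point b 0F                                             ≈⟨ combination-++ b ω (λ _ → K.0#) ⟩
    zPart b K.+ combination (b ∘ (m ↑ʳ_)) (λ _ → K.0#)     ≈⟨ K.+-congˡ (combination-zero (b ∘ (m ↑ʳ_)) (λ _ → K.refl)) ⟩
    zPart b K.+ K.0#                                       ≈⟨ K.+-identityʳ _ ⟩
    zPart b                                                ∎

  point₁ : ∀ b → point b 1F K.≈ zPart b K.^ q K.+ embed (b aIndex)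
  point₁ b = begin
    point b 1F
      ≈⟨ combination-++ b (λ i → ω i K.^ q) (K.1# ∷ λ _ → K.0#) ⟩
    combination (b ∘ (_↑ˡ 3)) (λ i → ω i K.^ q) K.+ combination (b ∘ (m ↑ʳ_)) (K.1# ∷ λ _ → K.0#)
      ≈⟨ K.+-cong (K.sym (IsLinear.combination-homo frobenius-linear (b ∘ (_↑ˡ 3)) ω))
           (K.+-cong (K.*-identityʳ _) (combination-zero (λ i → b (m ↑ʳ suc i)) (λ _ → K.refl))) ⟩
    zPart b K.^ q K.+ (embed (b aIndex) K.+ K.0#)
      ≈⟨ K.+-congˡ (K.+-identityʳ _) ⟩
    zPart b K.^ q K.+ embed (b aIndex) ∎

  point₂ : ∀ b → point b 2F K.≈ combination (λ i → b (m ↑ʳ suc i)) ε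
  point₂ b = begin
    point b 2F
      ≈⟨ combination-++ b (λ _ → K.0#) (K.0# ∷ ε) ⟩
    combination (b ∘ (_↑ˡ 3)) (λ _ → K.0#) K.+ combination (b ∘ (m ↑ʳ_)) (K.0# ∷ ε)
      ≈⟨ K.+-cong (combination-zero (b ∘ (_↑ˡ 3)) (λ _ → K.refl)) (K.+-congʳ (K.zeroʳ _)) ⟩
    K.0# K.+ (K.0# K.+ combination (λ i → b (m ↑ʳ suc i)) ε)
      ≈⟨ K.trans (K.+-identityˡ _) (K.+-identityˡ _) ⟩
    combination (λ i → b (m ↑ʳ suc i)) ε ∎

  K³ : LeftModule (fieldRing F) c′ ℓ′
  K³ = restrictScalars E (coordinateSpace K 3)

  point-coordinates : ∀ b i → LinearAlgebra.combination K³ b columns i K.≈ point b i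
  point-coordinates b i = IsLinear.combination-homo (evaluation-linear i) b columns

  -- The three coordinates of a vanishing point can be read in turn: the first gives z = 0, the
  -- second then leaves a = 0, and the third gives b = 0.
  columns-independent : LinearAlgebra.LinearlyIndependent K³ columns
  columns-independent b eq j = ≡.subst (λ j → b j F.≈ F.0#) (join-splitAt m 3 j) (onJoin (splitAt m j))
    where
    point≈0 : ∀ i → point b i K.≈ K.0#
    point≈0 i = K.trans (K.sym (point-coordinates b i)) (eq i)
    zPart≈0 : zPart b K.≈ K.0#
    zPart≈0 = K.trans (K.sym (point₀ b)) (point≈0 0F)
    a≈0 : b aIndex F.≈ F.0#
    a≈0 = injective (begin
      embed (b aIndex)                       ≈⟨ K.+-identityˡ _ ⟨
      K.0# K.+ embed (b aIndex)              ≈⟨ K.+-congʳ (K.trans (K.^-congˡ q zPart≈0) (IsLinear.0ᴹ-homo frobenius-linear)) ⟨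
      zPart b K.^ q K.+ embed (b aIndex)     ≈⟨ point₁ b ⟨
      point b 1F                             ≈⟨ point≈0 1F ⟩
      K.0#                                   ≈⟨ 0#-homo ⟨
      embed F.0#                             ∎)
    onJoin : ∀ s → b (join m 3 s) F.≈ F.0#
    onJoin (inj₁ i)       = ω-independent _ zPart≈0 i
    onJoin (inj₂ 0F)      = a≈0
    onJoin (inj₂ (suc i)) = ε-independent (λ i → b (m ↑ʳ suc i)) (K.trans (K.sym (point₂ b)) (point≈0 2F)) i

  -- Hyperplanes, codewords and non-degeneracy

  dot : Vector K.Carrier 3 → Vector K.Carrier 3 → K.Carrier
  dot = LK.combination

  dot-expand : ∀ x u → dot x u K.≈ (x 0F K.* u 0F K.+ x 1F K.* u 1F) K.+ x 2F K.* u 2F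
  dot-expand x u = K.trans (K.+-congˡ (K.+-congˡ (K.+-identityʳ _))) (K.sym (K.+-assoc _ _ _))

  -- The duality between geometry and code: the entries `dot x (columns j)` form the codeword of
  -- `x`, and `b` acts on it as an `F`-linear form.
  dot-point : ∀ x b → dot x (point b) K.≈ combination b (λ j → dot x (columns j))
  dot-point x b = K.trans (IsLinear.cong linear (λ i → K.sym (point-coordinates b i)))
                    (IsLinear.combination-homo linear (embed ∘ b) columns)
    where linear = combination-linearʳ K {n = 3} x

  dot-column-a : ∀ x → dot x (columns aIndex) K.≈ x 1F
  dot-column-a x = begin
    dot x (columns aIndex)
      ≈⟨ CK.combination-cong {a = x} (λ _ → K.refl) column ⟩
    dot x (K.0# ∷ K.1# ∷ K.0# ∷ [])
      ≈⟨ dot-expand x (K.0# ∷ K.1# ∷ K.0# ∷ []) ⟩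
    (x 0F K.* K.0# K.+ x 1F K.* K.1#) K.+ x 2F K.* K.0#
      ≈⟨ K.+-cong (K.+-cong (K.zeroʳ _) (K.*-identityʳ _)) (K.zeroʳ _) ⟩
    (K.0# K.+ x 1F) K.+ K.0#
      ≈⟨ K.trans (K.+-identityʳ _) (K.+-identityˡ _) ⟩
    x 1F ∎
    where
    column : ∀ i → columns aIndex i K.≈ (K.0# ∷ K.1# ∷ K.0# ∷ []) i
    column 0F = K.reflexive (lookup-++ʳ ω (λ _ → K.0#) 0F)
    column 1F = K.reflexive (lookup-++ʳ (λ i → ω i K.^ q) (K.1# ∷ λ _ → K.0#) 0F)
    column 2F = K.reflexive (lookup-++ʳ {m = m} (λ _ → K.0#) (K.0# ∷ ε) 0F)

  dot-column-ε : ∀ x i → dot x (columns (m ↑ʳ suc i)) K.≈ x 2F K.* ε i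
  dot-column-ε x i = begin
    dot x (columns (m ↑ʳ suc i))
      ≈⟨ CK.combination-cong {a = x} (λ _ → K.refl) column ⟩
    dot x (K.0# ∷ K.0# ∷ ε i ∷ [])
      ≈⟨ dot-expand x (K.0# ∷ K.0# ∷ ε i ∷ []) ⟩
    (x 0F K.* K.0# K.+ x 1F K.* K.0#) K.+ x 2F K.* ε i
      ≈⟨ K.+-congʳ (K.trans (K.+-cong (K.zeroʳ _) (K.zeroʳ _)) (K.+-identityʳ _)) ⟩
    K.0# K.+ x 2F K.* ε i
      ≈⟨ K.+-identityˡ _ ⟩
    x 2F K.* ε i ∎
    where
    column : ∀ j → columns (m ↑ʳ suc i) j K.≈ (K.0# ∷ K.0# ∷ ε i ∷ []) j
    column 0F = K.reflexive (lookup-++ʳ ω (λ _ → K.0#) (suc i))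
    column 1F = K.reflexive (lookup-++ʳ (λ i → ω i K.^ q) (K.1# ∷ λ _ → K.0#) (suc i))
    column 2F = K.reflexive (lookup-++ʳ {m = m} (λ _ → K.0#) (K.0# ∷ ε) (suc i))

  independent≉0 : ∀ {n} (v : Vector K.Carrier n) → LinearlyIndependent v → ∀ i → ¬ v i K.≈ K.0#
  independent≉0 v independent i vᵢ≈0 = F.1≉0 (F.trans (F.sym (unit-diagonal i))
    (independent (unit i) (K.trans (combination-unit i v) vᵢ≈0) i))

  -- The columns span K³ over `K`: they contain (0 , 1 , 0), a nonzero multiple of (0 , 0 , 1), and
  -- a vector with nonzero first coordinate. This is what gives the code dimension 3.
  dot-columns≈0 : ∀ x → (∀ j → dot x (columns j) K.≈ K.0#) → ∀ i → x i K.≈ K.0#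
  dot-columns≈0 x x⊥ = λ where
      0F → K.zeroProductʳ (independent≉0 ω ω-independent i₀) (begin
        ω i₀ K.* x 0F                             ≈⟨ K.*-comm _ _ ⟩
        x 0F K.* ω i₀                             ≈⟨ K.trans (K.+-identityʳ _) (K.+-identityʳ _) ⟨
        (x 0F K.* ω i₀ K.+ K.0#) K.+ K.0#         ≈⟨ K.+-cong (K.+-cong
             (K.*-congˡ (K.reflexive (lookup-++ˡ ω (λ _ → K.0#) i₀)))
             (K.trans (K.*-congʳ x₁≈0) (K.zeroˡ _)))
             (K.trans (K.*-congʳ x₂≈0) (K.zeroˡ _)) ⟨
        (x 0F K.* columns (i₀ ↑ˡ 3) 0F K.+ x 1F K.* columns (i₀ ↑ˡ 3) 1F) K.+ x 2F K.* columns (i₀ ↑ˡ 3) 2F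
                                                  ≈⟨ dot-expand x (columns (i₀ ↑ˡ 3)) ⟨
        dot x (columns (i₀ ↑ˡ 3))                 ≈⟨ x⊥ _ ⟩
        K.0#                                      ∎)
      1F → x₁≈0
      2F → x₂≈0
    where
    i₀ : Fin m
    i₀ = fromℕ< (ℕ.≤-trans (s≤s z≤n) 2≤m)
    x₁≈0 : x 1F K.≈ K.0#
    x₁≈0 = K.trans (K.sym (dot-column-a x)) (x⊥ _)
    x₂≈0 : x 2F K.≈ K.0#
    x₂≈0 = K.zeroProductʳ (independent≉0 ε ε-independent 0F)
      (K.trans (K.*-comm _ _) (K.trans (K.sym (dot-column-ε x 0F)) (x⊥ _)))

  combination-rows : ∀ x j → LinearAlgebra.combination (coordinateSpace K (m +ℕ 3)) x rows j K.≈ dot x (columns j)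
  combination-rows x j = IsLinear.combination-homo (CK.evaluation-linear j) x rows

  rows-independent : LinearAlgebra.LinearlyIndependent (coordinateSpace K (m +ℕ 3)) rows
  rows-independent x eq = dot-columns≈0 x (λ j → K.trans (K.sym (combination-rows x j)) (eq j))

  code : Code K (c′ ⊔ ℓ′) (m +ℕ 3) 3
  code = rowSpace K rows (s≤s z≤n) rows-independent

  -- An `F`-relation between the columns of `G` is a linear form that kills its rows, hence the
  -- whole code. It therefore kills `rows` as well and is a relation between `columns`.
  nonDegenerate : IsNonDegenerate E code
  nonDegenerate G isGenerator b eq = columns-independent b λ i → begin
    LinearAlgebra.combination K³ b columns i   ≈⟨ point-coordinates b i ⟩
    LK.combination (embed ∘ b) (rows i)        ≈⟨ annihilates (Combinations.member-Span (coordinateSpace K (m +ℕ 3)) rows i) ⟩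
    K.0#                                       ∎
    where
    open Code code using (Codeword)
    annihilates : ∀ {v} → v ∈ Codeword → LK.combination (embed ∘ b) v K.≈ K.0#
    annihilates {v} v∈C =
      let d , v≈ = LinearAlgebra.IsBasisOf.spanning isGenerator v∈C
          b-linear = combination-linearʳ K (embed ∘ b)
      in begin
        LK.combination (embed ∘ b) v
          ≈⟨ IsLinear.cong b-linear v≈ ⟩
        LK.combination (embed ∘ b) (LinearAlgebra.combination (coordinateSpace K (m +ℕ 3)) d G)
          ≈⟨ IsLinear.combination-homo b-linear d G ⟩
        LK.combination d (λ k → LK.combination (embed ∘ b) (G k))
          ≈⟨ CK.combination-zero d (λ k → K.trans
               (K.sym (IsLinear.combination-homo (evaluation-linear k) b (λ j i → G i j))) (eq k)) ⟩
        K.0# ∎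

  -- Points of U on a hyperplane

  point-injective : ∀ b b′ → (∀ i → point b i K.≈ point b′ i) → ∀ j → b j F.≈ b′ j
  point-injective b b′ eq = Combinations.independent-injective K³ columns-independent b b′ λ i →
    K.trans (point-coordinates b i) (K.trans (eq i) (K.sym (point-coordinates b′ i)))

  -- The linear set { (z , z^q) } is scattered.
  scattered : ∀ {z z′} → ¬ z K.≈ K.0# → z K.* z′ K.^ q K.≈ z K.^ q K.* z′ → ∃ λ t → z′ K.≈ embed t K.* z
  scattered {z} {z′} z≉0 eq with z⁻¹ , zz⁻¹≈1 ← K.inverse z≉0 =
    let t , t≈w = frobenius-fixed {z⁻¹ K.* z′} w^q≈w in
    t , (begin
      z′                     ≈⟨ zw≈z′ ⟨
      z K.* (z⁻¹ K.* z′)     ≈⟨ K.*-comm _ _ ⟩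
      z⁻¹ K.* z′ K.* z       ≈⟨ K.*-congʳ t≈w ⟨
      embed t K.* z          ∎)
    where
    w = z⁻¹ K.* z′
    zw≈z′ : z K.* w K.≈ z′
    zw≈z′ = K.trans (K.sym (K.*-assoc _ _ _)) (K.trans (K.*-congʳ zz⁻¹≈1) (K.*-identityˡ z′))
    -- Substituting z′ = z w into `eq` gives both sides the factors z and z^q, which cancel.
    w^q≈w : w K.^ q K.≈ w
    w^q≈w = K.*-cancelˡ-nonZero z≉0 (K.*-cancelˡ-nonZero (λ z^q≈0 → z≉0 (K.^-zero⇒≈0 q z^q≈0)) (begin
      z K.^ q K.* (z K.* w K.^ q)    ≈⟨ x∙yz≈y∙xz _ _ _ ⟩
      z K.* (z K.^ q K.* w K.^ q)    ≈⟨ K.*-congˡ (K.^-distrib-* z w q) ⟨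
      z K.* (z K.* w) K.^ q          ≈⟨ K.*-congˡ (K.^-congˡ q zw≈z′) ⟩
      z K.* z′ K.^ q                 ≈⟨ eq ⟩
      z K.^ q K.* z′                 ≈⟨ K.*-congˡ zw≈z′ ⟨
      z K.^ q K.* (z K.* w)          ∎))
      where open Algebra.Properties.CommutativeSemigroup K.*-commutativeSemigroup using (x∙yz≈y∙xz)

  -- On a hyperplane not containing (0 , 0 , 1), z and a determine b.
  z-injective : ∀ x → ¬ x 2F K.≈ K.0# → ∀ b b′ → b aIndex F.≈ b′ aIndex → dot x (point b) K.≈ K.0# →
    dot x (point b′) K.≈ K.0# → zPart b K.≈ zPart b′ → ∀ j → b j F.≈ b′ j
  z-injective x x₂≉0 b b′ a≈ x⊥b x⊥b′ z≈ = point-injective b b′ λ where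
      0F → p₀
      1F → p₁
      2F → K.*-cancelˡ-nonZero x₂≉0 (+-cancelˡ (x 0F K.* point b 0F K.+ x 1F K.* point b 1F) _ _ (begin
        (x 0F K.* point b 0F K.+ x 1F K.* point b 1F) K.+ x 2F K.* point b 2F     ≈⟨ dot-expand x (point b) ⟨
        dot x (point b)                                                           ≈⟨ K.trans x⊥b (K.sym x⊥b′) ⟩
        dot x (point b′)                                                          ≈⟨ dot-expand x (point b′) ⟩
        (x 0F K.* point b′ 0F K.+ x 1F K.* point b′ 1F) K.+ x 2F K.* point b′ 2F
          ≈⟨ K.+-congʳ (K.+-cong (K.*-congˡ p₀) (K.*-congˡ p₁)) ⟨
        (x 0F K.* point b 0F K.+ x 1F K.* point b 1F) K.+ x 2F K.* point b′ 2F    ∎))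
    where
    open Algebra.Properties.Group K.+-group using () renaming (∙-cancelˡ to +-cancelˡ)
    p₀ = K.trans (point₀ b) (K.trans z≈ (K.sym (point₀ b′)))
    p₁ = K.trans (point₁ b) (K.trans (K.+-cong (K.^-congˡ q z≈) (⟦⟧-cong a≈)) (K.sym (point₁ b′)))

  -- The hypothesis says U ∩ x^⊥ ⊆ y^⊥. Instead of a spanning set of `x^⊥`, each case uses
  -- individual points of `U` to force the coordinates of `y` to match a multiple of `x`.
  module Separation (x y : Vector K.Carrier 3)
    (x⊥⇒y⊥ : ∀ b → dot x (point b) K.≈ K.0# → dot y (point b) K.≈ K.0#) where
    open FieldProportionality K orderK

    x⊥columns⇒y⊥columns : ∀ j → dot x (columns j) K.≈ K.0# → dot y (columns j) K.≈ K.0#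
    x⊥columns⇒y⊥columns j x⊥ = K.trans (K.sym (atUnit y)) (x⊥⇒y⊥ (unit j) (K.trans (atUnit x) x⊥))
      where
      atUnit : ∀ w → dot w (point (unit j)) K.≈ dot w (columns j)
      atUnit w = CK.combination-cong {a = w} (λ _ → K.refl) (λ i → combination-unit j (rows i))

    -- The length `m + 3` exceeds `m + 2` by just enough to prescribe two zeros besides
    -- orthogonality to `x`.
    kernelPoint : ∀ i j → ∃ λ b → dot x (point b) K.≈ K.0# × b i F.≈ F.0# × b j F.≈ F.0# × ∃ λ k → ¬ b k F.≈ F.0#
    kernelPoint i j with b , x⊥b , rest ←
      nonZeroKernelVector (ℕ.+-monoʳ-< m (ℕ.n<1+n 2)) (combination-linear (λ j → dot x (columns j))) i j =
      b , K.trans (dot-point x b) x⊥b , rest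

    module _ (x₂≈0 : x 2F K.≈ K.0#) where
      y₂≈0 : y 2F K.≈ K.0#
      y₂≈0 = K.zeroProductʳ (independent≉0 ε ε-independent 0F) (K.trans (K.*-comm _ _)
        (K.trans (K.sym (dot-column-ε y 0F)) (x⊥columns⇒y⊥columns _
          (K.trans (dot-column-ε x 0F) (K.trans (K.*-congʳ x₂≈0) (K.zeroˡ _))))))

      -- Both prescribed zeros go to the coefficients of `ε`, so the point lies in the plane of the
      -- first two coordinates. It is nonzero because the columns are independent, and it is
      -- orthogonal to both `x` and `y`.
      det₀₁≈0 : x 0F K.* y 1F K.≈ x 1F K.* y 0F
      det₀₁≈0 with b , x⊥b , ε₀≈0 , ε₁≈0 , k , bₖ≉0 ← kernelPoint (m ↑ʳ 1F) (m ↑ʳ 2F) =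
        sharedKernel⇒det≈0
          (λ (p₀≈0 , p₁≈0) → bₖ≉0 (columns-independent b (λ where
            0F → K.trans (point-coordinates b 0F) p₀≈0
            1F → K.trans (point-coordinates b 1F) p₁≈0
            2F → K.trans (point-coordinates b 2F) p₂≈0) k))
          (planar x x⊥b) (planar y (x⊥⇒y⊥ b x⊥b))
        where
        p₂≈0 : point b 2F K.≈ K.0#
        p₂≈0 = K.trans (point₂ b) (K.trans
          (IsLinear.cong (combination-linear ε) {λ i → b (m ↑ʳ suc i)} {λ _ → F.0#}
            (λ { 0F → ε₀≈0 ; 1F → ε₁≈0 }))
          (IsLinear.0ᴹ-homo (combination-linear ε)))
        planar : ∀ w → dot w (point b) K.≈ K.0# → w 0F K.* point b 0F K.+ w 1F K.* point b 1F K.≈ K.0#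
        planar w w⊥b = begin
          w 0F K.* point b 0F K.+ w 1F K.* point b 1F    ≈⟨ K.+-identityʳ _ ⟨
          (w 0F K.* point b 0F K.+ w 1F K.* point b 1F) K.+ K.0#
            ≈⟨ K.+-congˡ (K.trans (K.*-congˡ p₂≈0) (K.zeroʳ _)) ⟨
          (w 0F K.* point b 0F K.+ w 1F K.* point b 1F) K.+ w 2F K.* point b 2F  ≈⟨ dot-expand w (point b) ⟨
          dot w (point b)                                ≈⟨ w⊥b ⟩
          K.0#                                           ∎

      minors : ∀ i j → x i K.* y j K.≈ x j K.* y i
      minors 0F 0F = K.refl
      minors 0F 1F = det₀₁≈0
      minors 1F 0F = K.sym det₀₁≈0
      minors 1F 1F = K.refl
      minors i  2F = K.trans (K.trans (K.*-congˡ y₂≈0) (K.zeroʳ _)) (K.sym (K.trans (K.*-congʳ x₂≈0) (K.zeroˡ _)))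
      minors 2F j  = K.trans (K.trans (K.*-congʳ x₂≈0) (K.zeroˡ _)) (K.sym (K.trans (K.*-congˡ y₂≈0) (K.zeroʳ _)))

    module _ (x₂≉0 : ¬ x 2F K.≈ K.0#) where
      private
        α = let x₂⁻¹ , _ = K.inverse x₂≉0 in y 2F K.* x₂⁻¹
        -- Subtracting from `y` the multiple of `x` that clears the third coordinate removes b from
        -- the equations, yet the result is still orthogonal to U ∩ x^⊥.
        residue : Vector K.Carrier 3
        residue i = y i K.+ (K.- α) K.* x i

      residue₂≈0 : residue 2F K.≈ K.0#
      residue₂≈0 with x₂⁻¹ , inv ← K.inverse x₂≉0 = begin
        y 2F K.+ (K.- (y 2F K.* x₂⁻¹)) K.* x 2F   ≈⟨ K.+-congˡ (-‿distribˡ-* _ _) ⟨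
        y 2F K.- y 2F K.* x₂⁻¹ K.* x 2F           ≈⟨ K.+-congˡ (K.-‿cong (K.trans (K.*-assoc _ _ _)
                                                       (K.trans (K.*-congˡ (K.trans (K.*-comm _ _) inv)) (K.*-identityʳ _)))) ⟩
        y 2F K.- y 2F                             ≈⟨ K.-‿inverseʳ _ ⟩
        K.0#                                      ∎
        where open Algebra.Properties.Ring K.ring using (-‿distribˡ-*)

      residue≈0⇒multiple : ∀ i → residue i K.≈ K.0# → y i K.≈ α K.* x i
      residue≈0⇒multiple i eq = x∙y⁻¹≈ε⇒x≈y _ _ (K.trans (K.+-congˡ (-‿distribˡ-* _ _)) eq)
        where open Algebra.Properties.Ring K.ring using (-‿distribˡ-*; x∙y⁻¹≈ε⇒x≈y)

      residue⊥ : ∀ b → dot x (point b) K.≈ K.0# → b aIndex F.≈ F.0# →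
                 zPart b K.* residue 0F K.+ zPart b K.^ q K.* residue 1F K.≈ K.0#
      residue⊥ b x⊥b a≈0 = begin
        zPart b K.* residue 0F K.+ zPart b K.^ q K.* residue 1F
          ≈⟨ K.+-cong (K.trans (K.*-comm _ _) (K.*-congˡ (K.sym (point₀ b))))
                      (K.trans (K.*-comm _ _) (K.*-congˡ (K.sym p₁))) ⟩
        residue 0F K.* point b 0F K.+ residue 1F K.* point b 1F
          ≈⟨ K.+-identityʳ _ ⟨
        (residue 0F K.* point b 0F K.+ residue 1F K.* point b 1F) K.+ K.0#
          ≈⟨ K.+-congˡ (K.trans (K.*-congʳ residue₂≈0) (K.zeroˡ _)) ⟨
        (residue 0F K.* point b 0F K.+ residue 1F K.* point b 1F) K.+ residue 2F K.* point b 2F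
          ≈⟨ dot-expand residue (point b) ⟨
        dot residue (point b)
          ≈⟨ L.+ᴹ-homo y (λ i → (K.- α) K.* x i) ⟩
        dot y (point b) K.+ dot (λ i → (K.- α) K.* x i) (point b)
          ≈⟨ K.+-cong (x⊥⇒y⊥ b x⊥b) (K.trans (L.*ₗ-homo (K.- α) x) (K.trans (K.*-congˡ x⊥b) (K.zeroʳ _))) ⟩
        K.0# K.+ K.0#
          ≈⟨ K.+-identityˡ _ ⟩
        K.0# ∎
        where
        module L = IsLinear (CK.combination-linear (point b))
        p₁ : point b 1F K.≈ zPart b K.^ q
        p₁ = K.trans (point₁ b) (K.trans (K.+-congˡ (K.trans (⟦⟧-cong a≈0) 0#-homo)) (K.+-identityʳ _))

      -- A nonzero residue would be orthogonal to (z , z^q) and (z′ , z′^q), so z′ = t z by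
      -- scatteredness and `b′` = t `b` on the hyperplane. Coefficient `k` then forces t = 0,
      -- although `b′` is nonzero.
      residue≈0 : residue 0F K.≈ K.0# × residue 1F K.≈ K.0#
      -- The first point needs only a = 0, so `aIndex` fills both slots.
      residue≈0 with b , x⊥b , a≈0 , _ , k , bₖ≉0 ← kernelPoint aIndex aIndex
                -- Vanishing at `k`, where `b` does not vanish, keeps the nonzero `b′` from being an
                -- `F`-multiple of `b`.
                with b′ , x⊥b′ , a′≈0 , b′ₖ≈0 , k′ , b′ₖ′≉0 ← kernelPoint aIndex k =
        Dec.decidable-stable ((residue 0F K.≟ K.0#) Dec.×-dec (residue 1F K.≟ K.0#)) λ ≉0 →
          let t , z′≈tz = scattered z≉0 (sharedKernel⇒det≈0 ≉0 (residue⊥ b x⊥b a≈0) (residue⊥ b′ x⊥b′ a′≈0))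
              b′≈tb = z-injective x x₂≉0 b′ (λ j → t F.* b j)
                (F.trans a′≈0 (F.sym (F.trans (F.*-congˡ a≈0) (F.zeroʳ t))))
                x⊥b′ (K.trans (x⊥-scale t) (K.trans (K.*-congˡ x⊥b) (K.zeroʳ _)))
                (K.trans z′≈tz (K.sym (IsLinear.*ₗ-homo (combination-linear ω) t (b ∘ (_↑ˡ 3)))))
              t≈0 = F.zeroProductʳ bₖ≉0 (F.trans (F.*-comm _ _) (F.trans (F.sym (b′≈tb k)) b′ₖ≈0))
          in b′ₖ′≉0 (F.trans (b′≈tb k′) (F.trans (F.*-congʳ t≈0) (F.zeroˡ _)))
        where
        x⊥-scale : ∀ t → dot x (point (λ j → t F.* b j)) K.≈ embed t K.* dot x (point b)
        x⊥-scale t = K.trans (dot-point x (λ j → t F.* b j))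
          (K.trans (IsLinear.*ₗ-homo (combination-linear (λ j → dot x (columns j))) t b)
            (K.*-congˡ (K.sym (dot-point x b))))
        z≉0 : ¬ zPart b K.≈ K.0#
        z≉0 z≈0 = bₖ≉0 (z-injective x x₂≉0 b (λ _ → F.0#) a≈0 x⊥b
          (K.trans (dot-point x (λ _ → F.0#)) (IsLinear.0ᴹ-homo (combination-linear (λ j → dot x (columns j)))))
          (K.trans z≈0 (K.sym (IsLinear.0ᴹ-homo (combination-linear ω)))) k)

      multiple : ∃ λ α → ∀ i → y i K.≈ α K.* x i
      multiple = α , λ where
        0F → residue≈0⇒multiple 0F (proj₁ residue≈0)
        1F → residue≈0⇒multiple 1F (proj₂ residue≈0)
        2F → residue≈0⇒multiple 2F residue₂≈0

    proportional : ∃ λ α → ∀ i → y i K.≈ α K.* x i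
    proportional with x 2F K.≟ K.0#
    ... | no x₂≉0  = multiple x₂≉0
    ... | yes x₂≈0 with all? (λ i → x i K.≟ K.0#)
    ...   | no ¬x≈0 with i , xᵢ≉0 ← ¬∀⟶∃¬ 3 _ (λ i → x i K.≟ K.0#) ¬x≈0 =
              minors≈0⇒multiple x y xᵢ≉0 (minors x₂≈0 i)
    -- For x = 0 every column is orthogonal to `x`, hence to `y`, which makes `y` zero too.
    ...   | yes x≈0 = K.0# , λ i → K.trans
              (dot-columns≈0 y (λ j → x⊥columns⇒y⊥columns j
                (K.trans (CK.combination-cong {v = columns j} x≈0 (λ _ → K.refl))
                  (IsLinear.0ᴹ-homo (CK.combination-linear (columns j))))) i)
              (K.sym (K.zeroˡ _))

  -- Minimality of the code

  isMinimal : ∀ (Γ : OrderedBasis E m) → IsMinimal E code Γ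
  isMinimal Γ v (x , v≈) v′ (y , v′≈) v′⊆v =
    let α , y≈αx = Separation.proportional x y x⊥⇒y⊥ in α , λ j → begin
      v′ j                              ≈⟨ v′≈dot j ⟩
      dot y (columns j)                 ≈⟨ CK.combination-cong {v = columns j} y≈αx (λ _ → K.refl) ⟩
      dot (λ i → α K.* x i) (columns j) ≈⟨ IsLinear.*ₗ-homo (CK.combination-linear (columns j)) α x ⟩
      α K.* dot x (columns j)           ≈⟨ K.*-congˡ (v≈dot j) ⟨
      α K.* v j                         ∎
    where
    v≈dot : ∀ j → v j K.≈ dot x (columns j)
    v≈dot j = K.trans (v≈ j) (combination-rows x j)
    v′≈dot : ∀ j → v′ j K.≈ dot y (columns j)
    v′≈dot j = K.trans (v′≈ j) (combination-rows y j)
    x⊥⇒y⊥ : ∀ b → dot x (point b) K.≈ K.0# → dot y (point b) K.≈ K.0#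
    x⊥⇒y⊥ b x⊥b = K.trans (dot-point y b) (K.trans (combination-cong (λ _ → F.refl) (λ j → K.sym (v′≈dot j)))
      (rankSupport-annihilator E Γ v v′ v′⊆v b
        (K.trans (combination-cong (λ _ → F.refl) v≈dot) (K.trans (K.sym (dot-point x b)) x⊥b))))

open import Data.Nat.Base using (_+_; _^_)

theorem7p16 : ∀ {c ℓ a c′ ℓ′ a′ : Level}
    (q : ℕ) → IsPrimePower q →
    (m : ℕ) → 4 ≤ m →
    (F : HeytingField c ℓ a) → HasOrder F q →
    (K : HeytingField c′ ℓ′ a′) → HasOrder K (q ^ m) →
    (E : Extension F K) →
    Σ (Code K (c′ ⊔ ℓ′) (m + 3) 3) λ C →
    IsNonDegenerate E C × (∀ (Γ : OrderedBasis E m) → IsMinimal E C Γ)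
theorem7p16 q primePower m 4≤m F orderF K orderK E = code , nonDegenerate , isMinimal
  where open Construction E orderF orderK primePower (ℕ.≤-trans (s≤s (s≤s z≤n)) 4≤m)
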